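{- For any fixed $n\ge 1$, the sequences $$\ell_{n,1}^{\mathrm{hook}},\ \ell_{n,2}^{\mathrm{hook}},\dots,\ell_{n,n}^{\mathrm{hook}}\quad\text{and}\quad i_{n,1}^{\mathrm{hook}},\ i_{n,2}^{\mathrm{hook}},\dots,i_{n,n}^{\mathrm{hook}}$$ are log concave.
   Context: $\mathfrak S_n$ is the set of permutations of $[n]=\{1,\dots,n\}$. For $\pi\in\mathfrak S_n$, $\ell(\pi)$ is the length of a longest increasing subsequence of $\pi$ (in one-line notation). The shape $\operatorname{sh}\pi$ is the common shape (a partition of $n$) of the two standard Young tableaux associated with $\pi$ by the Robinson–Schensted correspondence. Let $\mathrm{hook}$ be the set of all hook partitions of $n$, i.e. those of the form $(k,1^{n-k})$ with $1\le k\le n$ (first part $k$ followed by $n-k$ parts equal to $1$). Then $\ell_{n,k}^{\mathrm{hook}}$ is the number of $\pi\in\mathfrak S_n$ with $\ell(\pi)=k$ and $\operatorname{sh}\pi\in\mathrm{hook}$, and $i_{n,k}^{\mathrm{hook}}$ is the number of involutions $\pi\in\mathfrak S_n$ (permutations whose square is the identity) with $\ell(\pi)=k$ and $\operatorname{sh}\pi\in\mathrm{hook}$. A sequence of real numbers $l_1,\dots,l_n$ is log concave if $l_{k-1}l_{k+1}\le l_k^2$ for all $1\le k\le n$, with the convention $l_0=l_{n+1}=0$. -}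

module Defs where

open import Algebra.Definitions using (Involutive)
open import Data.Bool using (if_then_else_; _∧_)
open import Data.Fin as Fin using (Fin; toℕ)
open import Data.Fin.Properties as Fin using (all?; any?)
open import Data.List using (List; []; _∷_; _++_; _∷ʳ_; map; length; filter; replicate; allFin; cartesianProductWith)
open import Data.List.Extrema.Nat using (max)
open import Data.List.Properties using (≡-dec; length-++)
open import Data.List.Relation.Unary.Linked using (Linked; linked?)
open import Data.Maybe using (Maybe; just; nothing)
open import Data.Nat using (ℕ; zero; suc; _+_; _*_; _∸_; _^_; _≤_; _<_; _≤ᵇ_; _≟_; _≤?_; _<?_; s≤s; s≤s⁻¹)
open import Data.Nat.Properties using (anyUpTo?; +-comm)
open import Data.Product using (_×_; _,_; proj₁; proj₂; ∃)
open import Data.Vec as Vec using (Vec; []; _∷_; lookup)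
open import Function.Definitions using (Injective; Surjective; Bijective)
open import Relation.Binary.PropositionalEquality using (_≡_; refl; sym; trans; cong)
open import Relation.Nullary using (Dec)
open import Relation.Nullary.Decidable using (map′; _×-dec_; _→-dec_; yes; no)
open import Relation.Unary using (Decidable)

-- w stands for the map i ↦ lookup w i, with [n] represented by Fin n.
IsPermutation : ∀ {n} → Vec (Fin n) n → Set
IsPermutation w = Bijective _≡_ _≡_ (lookup w)

isPermutation? : ∀ {n} → Decidable (IsPermutation {n})
isPermutation? w = injective? ×-dec surjective?
  where
  injective? : Dec (Injective _≡_ _≡_ (lookup w))
  injective? = map′ (λ f {i} {j} → f i j) (λ f i j → f {i} {j})
    (all? λ i → all? λ j → (lookup w i Fin.≟ lookup w j) →-dec (i Fin.≟ j))

  surjective? : Dec (Surjective _≡_ _≡_ (lookup w))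
  surjective? = map′
    (λ f y → proj₁ (f y) , λ { refl → proj₂ (f y) })
    (λ f y → proj₁ (f y) , proj₂ (f y) refl)
    (all? λ y → any? λ x → lookup w x Fin.≟ y)

-- All words of length m over the alphabet Fin n, each listed once.
words : ∀ n m → List (Vec (Fin n) m)
words n zero    = [] ∷ []
words n (suc m) = cartesianProductWith _∷_ (allFin n) (words n m)

𝔖 : ∀ n → List (Vec (Fin n) n)
𝔖 n = filter isPermutation? (words n n)

-- π(1), …, π(n), shifted from Fin n to {1, …, n}.
oneLine : ∀ {n} → Vec (Fin n) n → List ℕ
oneLine w = map (λ i → suc (toℕ i)) (Vec.toList w)

IsInvolution : ∀ {n} → Vec (Fin n) n → Set
IsInvolution w = Involutive _≡_ (lookup w)

isInvolution? : ∀ {n} → Decidable (IsInvolution {n})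
isInvolution? w = all? λ i → lookup w (lookup w i) Fin.≟ i

subsequences : ∀ {A : Set} → List A → List (List A)
subsequences []       = [] ∷ []
subsequences (x ∷ xs) = map (x ∷_) (subsequences xs) ++ subsequences xs

lis : List ℕ → ℕ
lis xs = max 0 (map length (filter (linked? _<?_) (subsequences xs)))

ℓ : ∀ {n} → Vec (Fin n) n → ℕ
ℓ w = lis (oneLine w)

-- A tableau is the list of its rows, top row first.
Tableau : Set
Tableau = List (List ℕ)

-- The leftmost entry larger than x, if any, is replaced by x and bumped out;
-- otherwise x goes at the end of the row.
rowInsert : ℕ → List ℕ → List ℕ × Maybe ℕ
rowInsert x []       = x ∷ [] , nothing
rowInsert x (y ∷ ys) with x <? y
... | yes _ = x ∷ ys , just y
... | no  _ = y ∷ proj₁ (rowInsert x ys) , proj₂ (rowInsert x ys)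

-- The second component is the (0-based) index of the row that gets longer.
insert : ℕ → Tableau → Tableau × ℕ
insert x []       = (x ∷ []) ∷ [] , 0
insert x (r ∷ rs) with rowInsert x r
... | r′ , nothing = r′ ∷ rs , 0
... | r′ , just y  = r′ ∷ proj₁ (insert y rs) , suc (proj₂ (insert y rs))

-- Append an entry to the row with the given index.  The index never exceeds
-- the number of rows when place is used in RS.
place : ℕ → ℕ → Tableau → Tableau
place k       i []       = (i ∷ []) ∷ []
place zero    i (r ∷ rs) = (r ∷ʳ i) ∷ rs
place (suc k) i (r ∷ rs) = r ∷ place k i rs

-- i is the label that the next new cell receives in the recording tableau Q.
RSfrom : ℕ → Tableau × Tableau → List ℕ → Tableau × Tableau
RSfrom i PQ      []       = PQ
RSfrom i (P , Q) (x ∷ xs) =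
  RSfrom (suc i) (proj₁ (insert x P) , place (proj₂ (insert x P)) i Q) xs

RS : List ℕ → Tableau × Tableau
RS = RSfrom 1 ([] , [])

shape : Tableau → List ℕ
shape = map length

-- By common-shape below, the recording tableau has this shape as well.
sh : ∀ {n} → Vec (Fin n) n → List ℕ
sh w = shape (proj₁ (RS (oneLine w)))

grow : ℕ → List ℕ → List ℕ
grow k       []       = 1 ∷ []
grow zero    (a ∷ as) = suc a ∷ as
grow (suc k) (a ∷ as) = a ∷ grow k as

delta : Maybe ℕ → ℕ → ℕ
delta nothing  m = suc m
delta (just _) m = m

suc-delta : ∀ b m → delta b (suc m) ≡ suc (delta b m)
suc-delta nothing  m = refl
suc-delta (just _) m = refl

length-rowInsert : ∀ x r →
  length (proj₁ (rowInsert x r)) ≡ delta (proj₂ (rowInsert x r)) (length r)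
length-rowInsert x []       = refl
length-rowInsert x (y ∷ ys) with x <? y
... | yes _ = refl
... | no  _ = trans (cong suc (length-rowInsert x ys))
                    (sym (suc-delta (proj₂ (rowInsert x ys)) (length ys)))

shape-insert : ∀ x P →
  shape (proj₁ (insert x P)) ≡ grow (proj₂ (insert x P)) (shape P)
shape-insert x []       = refl
shape-insert x (r ∷ rs) with rowInsert x r | length-rowInsert x r
... | r′ , nothing | eq rewrite eq = refl
... | r′ , just y  | eq rewrite eq = cong (length r ∷_) (shape-insert y rs)

shape-place : ∀ k i Q → shape (place k i Q) ≡ grow k (shape Q)
shape-place zero    i []       = refl
shape-place (suc k) i []       = refl
shape-place zero    i (r ∷ rs) =
  cong (_∷ shape rs) (trans (length-++ r) (+-comm (length r) 1))
shape-place (suc k) i (r ∷ rs) = cong (length r ∷_) (shape-place k i rs)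

shape-RSfrom : ∀ i P Q xs → shape P ≡ shape Q →
  shape (proj₁ (RSfrom i (P , Q) xs)) ≡ shape (proj₂ (RSfrom i (P , Q) xs))
shape-RSfrom i P Q []       eq = eq
shape-RSfrom i P Q (x ∷ xs) eq = shape-RSfrom (suc i) _ _ xs
  (trans (shape-insert x P)
    (trans (cong (grow k) eq) (sym (shape-place k i Q))))
  where k = proj₂ (insert x P)

common-shape : ∀ xs → shape (proj₁ (RS xs)) ≡ shape (proj₂ (RS xs))
common-shape xs = shape-RSfrom 1 [] [] xs refl

IsHook : ℕ → List ℕ → Set
IsHook n p = ∃ λ k → k ≤ n × 1 ≤ k × p ≡ k ∷ replicate (n ∸ k) 1

isHook? : ∀ n → Decidable (IsHook n)
isHook? n p = map′
  (λ { (k , k<1+n , h) → k , s≤s⁻¹ k<1+n , h })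
  (λ { (k , k≤n , h) → k , s≤s k≤n , h })
  (anyUpTo? (λ k → (1 ≤? k) ×-dec ≡-dec _≟_ p (k ∷ replicate (n ∸ k) 1)) (suc n))

ℓ-hook : ℕ → ℕ → ℕ
ℓ-hook n k = length (filter (λ w → (ℓ w ≟ k) ×-dec isHook? n (sh w)) (𝔖 n))

i-hook : ℕ → ℕ → ℕ
i-hook n k = length (filter
  (λ w → isInvolution? w ×-dec ((ℓ w ≟ k) ×-dec isHook? n (sh w))) (𝔖 n))

-- The sequence l₁, …, lₙ extended by zero; values of l outside {1, …, n}
-- are ignored.
extend : ℕ → (ℕ → ℕ) → ℕ → ℕ
extend n l k = if (1 ≤ᵇ k) ∧ (k ≤ᵇ n) then l k else 0

LogConcave : ℕ → (ℕ → ℕ) → Set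
LogConcave n l = ∀ k → 1 ≤ k → k ≤ n →
  extend n l (k ∸ 1) * extend n l (suc k) ≤ extend n l k ^ 2

{-# OPTIONS --safe #-}
-- A permutation of hook shape is determined by the ascent words of itself and
-- of its inverse: the first is read off the recording tableau, the second off
-- the insertion tableau, and any two words of length n - 1 with k - 1 ascents
-- occur.  Hence ℓ-hook n k = C(n-1,k-1)².  The hook condition is inherited by
-- the inverse, since it says that a longest increasing and a longest decreasing
-- subsequence have n + 1 entries in total; so the involutions are the
-- permutations whose two words agree, and i-hook n k = C(n-1,k-1).
module Submission where

open import Defs
open import Data.Bool using (Bool; true; false)
open import Data.Empty using (⊥; ⊥-elim)
open import Data.Fin using (Fin; zero; suc; toℕ; fromℕ<)
import Data.Fin.Properties as Fin
open import Data.List using (List; []; _∷_; _++_; _∷ʳ_; _ʳ++_; [_]; map; length; foldl; foldr; filter; reverse; replicate; drop; downFrom; initLast; _∷ʳ′_; cartesianProduct)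
open import Data.List.Extrema.Nat using (v≤max⁺; max≤v⁺)
open import Data.List.Membership.Propositional using (_∈_; _∉_)
open import Data.List.Membership.Propositional.Properties using (∈-++⁺ˡ; ∈-++⁺ʳ; ∈-++⁻; ∈-map⁺; ∈-map⁻; ∈-filter⁺; ∈-filter⁻; ∈-downFrom⁺; ∈-downFrom⁻; ∈-∃++; ∈-allFin; ∈-cartesianProduct⁺; ∈-cartesianProduct⁻; ∈-cartesianProductWith⁺)
open import Data.List.Properties using (length-++; length-map; length-reverse; length-downFrom; ++-assoc; ∷-injective; ∷ʳ-injective; map-injective; unfold-reverse; reverse-foldr; reverse-injective; reverse-involutive)
open import Data.List.Relation.Binary.Permutation.Propositional using (_↭_; ↭⇒↭ₛ; ↭-refl; ↭-sym; ↭-trans; prep; swap)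
open import Data.List.Relation.Binary.Permutation.Propositional.Properties using (∈-resp-↭; All-resp-↭; shift; ∷↭∷ʳ; ++⁺ʳ; ↭-length; ↭-reverse)
open import Data.List.Relation.Unary.All as All using (All; []; _∷_)
import Data.List.Relation.Unary.All.Properties as All
open import Data.List.Relation.Unary.AllPairs using (AllPairs; []; _∷_)
import Data.List.Relation.Unary.AllPairs.Properties as AllPairs
open import Data.List.Relation.Unary.Any as Any using (here; there)
open import Data.List.Relation.Unary.Linked as Linked using (Linked; linked?; []; [-]; _∷_)
open import Data.List.Relation.Unary.Unique.Propositional using (Unique)
import Data.List.Relation.Unary.Unique.Propositional.Properties as Unique
open import Data.Maybe using (Maybe; just; nothing; maybe)
open import Data.Nat using (ℕ; zero; suc; _+_; _*_; _∸_; _^_; _≤_; _<_; _>_; _≤ᵇ_; z≤n; s≤s; s≤s⁻¹; _≟_; _<?_)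
open import Data.Nat.Combinatorics using (_C_; nCk+nC[k+1]≡[n+1]C[k+1])
open import Data.Nat.ListAction using (sum)
open import Data.Nat.Properties
open import Data.Nat.Tactic.RingSolver using (solve-∀)
open import Data.Product using (_×_; _,_; proj₁; proj₂; ∃; ∃₂)
open import Data.Sum using (_⊎_; inj₁; inj₂)
open import Data.Vec using (Vec; []; _∷_; lookup; tabulate; toList)
open import Data.Vec.Properties as Vec using (lookup∘tabulate; tabulate∘lookup; tabulate-cong; cast-is-id; toList-injective; length-toList)
open import Function using (_∘_; flip; id)
open import Relation.Binary.Definitions using (tri<; tri≈; tri>)
open import Relation.Binary.PropositionalEquality using (_≡_; _≢_; refl; sym; trans; cong; cong₂; subst; subst₂; setoid)
open import Relation.Nullary using (does; yes; no; contradiction)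
open import Relation.Nullary.Decidable using (_×-dec_; dec-true; dec-false)
open import Data.List.Relation.Binary.Permutation.Setoid.Properties (setoid ℕ) using (Unique-resp-↭)

-- The link between a permutation and its inverse comes from one-sided bounds. For every word, an
-- increasing subsequence has at most as many entries as the first row of the insertion tableau, and
-- a decreasing one at most as many as there are rows. An insertion that passes through hooks
-- exhibits subsequences attaining both lengths. Inversion carries these to the inverse, whose
-- tableau has just as many cells, so no cell is left to spoil the hook. Words can serve as codes
-- because a standard hook tableau is determined by which of 2, ..., n lie in its first row. In the
-- recording tableau this is decided by the ascents of the permutation, since a hook insertion bumps
-- exactly at a descent. In the insertion tableau it is decided by the ascents of the inverse, since
-- v + 1 lies in the row exactly if v stands before it. Two words with equally many ascents belong
-- to tableaux of one shape, and reverse insertion joins any such pair. Words are kept backwards so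
-- that insertion is a `foldr` and every induction peels off the entry inserted last.

-- Tableaux and bumping

-- The lists given to tab, Run and At below are permutations read backwards; there a
-- chain for _<_ is an increasing subsequence with last entry below b, and a
-- chain for _>_ a decreasing one with last entry above b.
data Chain (_~_ : ℕ → ℕ → Set) : ℕ → ℕ → List ℕ → Set where
  done : ∀ {b xs} → Chain _~_ b 0 xs
  take : ∀ {b j x xs} → x ~ b → Chain _~_ x j xs → Chain _~_ b (suc j) (x ∷ xs)
  skip : ∀ {b j x xs} → Chain _~_ b j xs → Chain _~_ b j (x ∷ xs)

Chain-rebase : ∀ {_~_ b c j xs} → (∀ {x} → x ~ b → x ~ c) →
  Chain _~_ b j xs → Chain _~_ c j xs
Chain-rebase f done       = done
Chain-rebase f (take p c) = take (f p) c
Chain-rebase f (skip c)   = skip (Chain-rebase f c)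

Chain-<-mono : ∀ {b c j xs} → b ≤ c → Chain _<_ b j xs → Chain _<_ c j xs
Chain-<-mono b≤c = Chain-rebase (λ x<b → <-≤-trans x<b b≤c)

Chain->-mono : ∀ {b c j xs} → c ≤ b → Chain _>_ b j xs → Chain _>_ c j xs
Chain->-mono c≤b = Chain-rebase (λ b<x → ≤-<-trans c≤b b<x)

-- The non-strict bounds mirror the test `x <? y`; when the entries are distinct, `≤∧∉⇒<` makes them
-- strict.
data RowInsertion (x : ℕ) : List ℕ → List ℕ × Maybe ℕ → Set where
  append  : ∀ {r} → All (_≤ x) r → RowInsertion x r (r ∷ʳ x , nothing)
  replace : ∀ {as y bs} → All (_≤ x) as → x < y →
            RowInsertion x (as ++ y ∷ bs) (as ++ x ∷ bs , just y)

rowInsertion : ∀ x r → RowInsertion x r (rowInsert x r)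
rowInsertion x [] = append []
rowInsertion x (y ∷ ys) with x <? y
... | yes x<y = replace [] x<y
... | no  x≮y with rowInsert x ys | rowInsertion x ys
...   | _ | append ps      = append (≮⇒≥ x≮y ∷ ps)
...   | _ | replace ps x<z = replace (≮⇒≥ x≮y ∷ ps) x<z

rowInsert-append : ∀ {x r} → All (_< x) r → rowInsert x r ≡ (r ∷ʳ x , nothing)
rowInsert-append [] = refl
rowInsert-append {x} {y ∷ ys} (y<x ∷ ps) with x <? y
... | yes x<y = contradiction y<x (<-asym x<y)
... | no  _ rewrite rowInsert-append ps = refl

rowInsert-replace : ∀ {x y as bs} → All (_< x) as → x < y →
  rowInsert x (as ++ y ∷ bs) ≡ (as ++ x ∷ bs , just y)
rowInsert-replace {x} {y} [] x<y with x <? y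
... | yes _   = refl
... | no  x≮y = contradiction x<y x≮y
rowInsert-replace {x} {as = a ∷ as} {bs} (a<x ∷ ps) x<y with x <? a
... | yes x<a = contradiction a<x (<-asym x<a)
... | no  _ rewrite rowInsert-replace {as = as} {bs} ps x<y = refl

tab : List ℕ → Tableau
tab = foldr (λ x T → proj₁ (insert x T)) []

row : List ℕ → List ℕ
row = foldr (λ x r → proj₁ (rowInsert x r)) []

bumped : List ℕ → List ℕ
bumped []       = []
bumped (x ∷ xs) = maybe (_∷ bumped xs) (bumped xs) (proj₂ (rowInsert x (row xs)))

insert-∷ : ∀ x r rs → proj₁ (insert x (r ∷ rs)) ≡
  proj₁ (rowInsert x r) ∷ maybe (λ y → proj₁ (insert y rs)) rs (proj₂ (rowInsert x r))
insert-∷ x r rs with rowInsert x r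
... | _ , nothing = refl
... | _ , just _  = refl

-- The rows below the first see only the entries bumped out of it, in the order of bumping. This
-- allows induction on the number of rows.
tab-∷ : ∀ x xs → tab (x ∷ xs) ≡ row (x ∷ xs) ∷ tab (bumped (x ∷ xs))
tab-∷ x []       = refl
tab-∷ x (y ∷ ys) rewrite tab-∷ y ys
  | insert-∷ x (row (y ∷ ys)) (tab (bumped (y ∷ ys)))
  with proj₂ (rowInsert x (row (y ∷ ys)))
... | nothing = refl
... | just _  = refl

tab-reverse : ∀ xs → proj₁ (RS xs) ≡ tab (reverse xs)
tab-reverse xs = trans (RSfrom-foldl 1 [] [] xs) (sym (reverse-foldr _ [] xs))
  where
  RSfrom-foldl : ∀ i P Q xs →
    proj₁ (RSfrom i (P , Q) xs) ≡ foldl (λ T x → proj₁ (insert x T)) P xs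
  RSfrom-foldl i P Q []       = refl
  RSfrom-foldl i P Q (x ∷ xs) = RSfrom-foldl (suc i) _ _ xs

-- Chains bounded by the first row and by the number of rows

countBelow : ℕ → List ℕ → ℕ
countBelow b [] = 0
countBelow b (y ∷ ys) with y <? b
... | yes _ = suc (countBelow b ys)
... | no  _ = countBelow b ys

countBelow≤length : ∀ b r → countBelow b r ≤ length r
countBelow≤length b [] = z≤n
countBelow≤length b (y ∷ ys) with y <? b
... | yes _ = s≤s (countBelow≤length b ys)
... | no  _ = m≤n⇒m≤1+n (countBelow≤length b ys)

countBelow-mono : ∀ {b c} r → b ≤ c → countBelow b r ≤ countBelow c r
countBelow-mono [] b≤c = z≤n
countBelow-mono {b} {c} (y ∷ ys) b≤c with y <? b | y <? c
... | yes _   | yes _   = s≤s (countBelow-mono ys b≤c)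
... | yes y<b | no  y≮c = contradiction (<-≤-trans y<b b≤c) y≮c
... | no  _   | yes _   = m≤n⇒m≤1+n (countBelow-mono ys b≤c)
... | no  _   | no  _   = countBelow-mono ys b≤c

countBelow-∷-mono : ∀ {b x y} r → x ≤ y → countBelow b (y ∷ r) ≤ countBelow b (x ∷ r)
countBelow-∷-mono {b} {x} {y} r x≤y with y <? b | x <? b
... | yes _   | yes _   = ≤-refl
... | yes y<b | no  x≮b = contradiction (≤-<-trans x≤y y<b) x≮b
... | no  _   | yes _   = n≤1+n _
... | no  _   | no  _   = ≤-refl

countBelow-insert : ∀ {b} x r → countBelow b r ≤ countBelow b (proj₁ (rowInsert x r))
countBelow-insert x [] = z≤n
countBelow-insert {b} x (y ∷ ys) with x <? y
... | yes x<y = countBelow-∷-mono {b} {x} ys (<⇒≤ x<y)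
... | no  _ with y <? b
...   | yes _ = s≤s (countBelow-insert x ys)
...   | no  _ = countBelow-insert x ys

-- The entries below `x` stay in the row and `x` joins them below `b`; an entry displaced by `x`
-- exceeds `x`, so it was not among those counted.
countBelow-insert-< : ∀ {b} x r → x < b →
  suc (countBelow x r) ≤ countBelow b (proj₁ (rowInsert x r))
countBelow-insert-< {b} x [] x<b with x <? b
... | yes _   = s≤s z≤n
... | no  x≮b = contradiction x<b x≮b
countBelow-insert-< {b} x (y ∷ ys) x<b with x <? y
... | yes x<y with y <? x | x <? b
...   | yes y<x | _       = contradiction y<x (<-asym x<y)
...   | no  _   | yes _   = s≤s (countBelow-mono ys (<⇒≤ x<b))
...   | no  _   | no  x≮b = contradiction x<b x≮b
countBelow-insert-< {b} x (y ∷ ys) x<b | no x≮y with y <? x | y <? b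
... | yes _   | yes _   = s≤s (countBelow-insert-< x ys x<b)
... | yes y<x | no  y≮b = contradiction (<-trans y<x x<b) y≮b
... | no  _   | yes _   = m≤n⇒m≤1+n (countBelow-insert-< x ys x<b)
... | no  _   | no  _   = countBelow-insert-< x ys x<b

-- One inequality of Schensted's theorem, refined by the bound `b`: the length of the row alone
-- would not tell that taking `x` extends a chain lying below `x`.
chain≤countBelow : ∀ {b j xs} → Chain _<_ b j xs → j ≤ countBelow b (row xs)
chain≤countBelow done = z≤n
chain≤countBelow {xs = x ∷ xs} (take x<b c) =
  ≤-trans (s≤s (chain≤countBelow c)) (countBelow-insert-< x (row xs) x<b)
chain≤countBelow {xs = x ∷ xs} (skip c) =
  ≤-trans (chain≤countBelow c) (countBelow-insert x (row xs))

chain≤row : ∀ {b j xs} → Chain _<_ b j xs → j ≤ length (row xs)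
chain≤row {b} {xs = xs} c = ≤-trans (chain≤countBelow c) (countBelow≤length b (row xs))

Sorted : List ℕ → Set
Sorted = AllPairs _≤_

AllPairs-++⁻ : ∀ {R : ℕ → ℕ → Set} as {bs} → AllPairs R (as ++ bs) →
  AllPairs R as × AllPairs R bs × All (λ a → All (R a) bs) as
AllPairs-++⁻ [] ps = [] , ps , []
AllPairs-++⁻ (a ∷ as) (p ∷ ps) with AllPairs-++⁻ as ps | All.++⁻ as p
... | qs , rs , ss | p₁ , p₂ = p₁ ∷ qs , rs , p₂ ∷ ss

rowInsert-sorted : ∀ x r → Sorted r → Sorted (proj₁ (rowInsert x r))
rowInsert-sorted x r sr with rowInsert x r | rowInsertion x r
... | _ | append r≤x = AllPairs.++⁺ sr ([] ∷ []) (All.map (_∷ []) r≤x)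
... | _ | replace {as} as≤x x<y with AllPairs-++⁻ as sr
...   | sas , y≤bs ∷ sbs , as≤ =
  AllPairs.++⁺ sas (All.map (λ y≤b → ≤-trans (<⇒≤ x<y) y≤b) y≤bs ∷ sbs)
    (All.zipWith (λ { (a≤x , _ ∷ a≤bs) → a≤x ∷ a≤bs }) (as≤x , as≤))

row-sorted : ∀ xs → Sorted (row xs)
row-sorted []       = []
row-sorted (x ∷ xs) = rowInsert-sorted x (row xs) (row-sorted xs)

∈-rowInsert : ∀ x r → x ∈ proj₁ (rowInsert x r)
∈-rowInsert x r with rowInsert x r | rowInsertion x r
... | _ | append _       = ∈-++⁺ʳ r (here refl)
... | _ | replace {as} _ _ = ∈-++⁺ʳ as (here refl)

rowInsert-retains : ∀ {y} x r → y ∈ r →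
  y ∈ proj₁ (rowInsert x r) ⊎ proj₂ (rowInsert x r) ≡ just y
rowInsert-retains x r y∈r with rowInsert x r | rowInsertion x r
... | _ | append _ = inj₁ (∈-++⁺ˡ y∈r)
... | _ | replace {as} _ _ with ∈-++⁻ as y∈r
...   | inj₁ y∈as         = inj₁ (∈-++⁺ˡ y∈as)
...   | inj₂ (here refl)  = inj₂ refl
...   | inj₂ (there y∈bs) = inj₁ (∈-++⁺ʳ as (there y∈bs))

rowInsert-bumps : ∀ {y} x r → Sorted r → y ∈ r → x < y →
  ∃ λ z → proj₂ (rowInsert x r) ≡ just z × x < z × z ≤ y
rowInsert-bumps x r sr y∈r x<y with rowInsert x r | rowInsertion x r
... | _ | append r≤x = contradiction x<y (≤⇒≯ (All.lookup r≤x y∈r))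
... | _ | replace {as} {z} as≤x x<z with ∈-++⁻ as y∈r | AllPairs-++⁻ as sr
...   | inj₁ y∈as         | _ = contradiction x<y (≤⇒≯ (All.lookup as≤x y∈as))
...   | inj₂ (here refl)  | _ = z , refl , x<z , ≤-refl
...   | inj₂ (there y∈bs) | _ , z≤bs ∷ _ , _ = z , refl , x<z , All.lookup z≤bs y∈bs

-- A decreasing subsequence loses only one entry in passing to the bumped word:
-- its member y either stays in the row, where the next member x < y bumps some
-- z with x < z ≤ y, or has itself been bumped.
chain-bumped : ∀ {b j} xs → Chain _>_ b (suc j) xs →
  (∃ λ y → y ∈ row xs × b < y × Chain _>_ y j (bumped xs)) ⊎ Chain _>_ b (suc j) (bumped xs)
chain-bumped (x ∷ xs) (skip c) with chain-bumped xs c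
... | inj₁ (y , y∈r , b<y , d) with rowInsert-retains x (row xs) y∈r
...   | inj₂ bump rewrite bump = inj₂ (take b<y d)
...   | inj₁ y∈r′ with proj₂ (rowInsert x (row xs))
...     | nothing = inj₁ (y , y∈r′ , b<y , d)
...     | just _  = inj₁ (y , y∈r′ , b<y , skip d)
chain-bumped (x ∷ xs) (skip c) | inj₂ d with proj₂ (rowInsert x (row xs))
... | nothing = inj₂ d
... | just _  = inj₂ (skip d)
chain-bumped {j = zero} (x ∷ xs) (take b<x c) =
  inj₁ (x , ∈-rowInsert x (row xs) , b<x , done)
chain-bumped {j = suc j} (x ∷ xs) (take b<x c) with chain-bumped xs c
... | inj₁ (y , y∈r , x<y , d) with rowInsert-bumps x (row xs) (row-sorted xs) y∈r x<y
...   | z , bump , x<z , z≤y =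
  inj₁ (x , ∈-rowInsert x (row xs) , b<x ,
    subst (λ m → Chain _>_ x (suc j) (maybe (_∷ bumped xs) (bumped xs) m)) (sym bump)
      (take x<z (Chain->-mono z≤y d)))
chain-bumped {j = suc j} (x ∷ xs) (take b<x c) | inj₂ d =
  inj₁ (x , ∈-rowInsert x (row xs) , b<x , lift)
  where
  lift : Chain _>_ x (suc j) (bumped (x ∷ xs))
  lift with proj₂ (rowInsert x (row xs))
  ... | nothing = d
  ... | just _  = skip d

-- Removing the first row costs a decreasing subsequence at most one entry, by `chain-bumped`, so
-- each entry is paid for by a row. `lower` weakens both outcomes of that lemma to a chain of length
-- `j`.
chain≤rows : ∀ {b} j xs → Chain _>_ b j xs → j ≤ length (tab xs)
chain≤rows zero    xs       c = z≤n
chain≤rows (suc j) (x ∷ xs) c rewrite tab-∷ x xs =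
  s≤s (chain≤rows j _ (lower (chain-bumped (x ∷ xs) c)))
  where
  Chain-pred : ∀ {b j ys} → Chain _>_ b (suc j) ys → Chain _>_ b j ys
  Chain-pred (skip c)                = skip (Chain-pred c)
  Chain-pred {j = zero}  (take b<y c) = done
  Chain-pred {j = suc _} (take b<y c) = take b<y (Chain-pred c)
  lower : ∀ {b j r ys} →
    (∃ λ y → y ∈ r × b < y × Chain _>_ y j ys) ⊎ Chain _>_ b (suc j) ys → Chain _>_ b j ys
  lower (inj₁ (y , _ , b<y , d)) = Chain->-mono (<⇒≤ b<y) d
  lower (inj₂ d) = Chain-pred d

-- Hook insertions

-- Run xs r c d: row insertion of xs passes through hooks only and ends with first
-- row r and, below its corner, first column c; d records whether a step
-- lengthened the row (true) or the column (false), latest step first.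
data Run : List ℕ → List ℕ → List ℕ → List Bool → Set where
  start : ∀ {x} → Run (x ∷ []) (x ∷ []) [] []
  asc   : ∀ {x xs r c d} → Run xs r c d → All (_< x) r →
          Run (x ∷ xs) (r ∷ʳ x) c (true ∷ d)
  desc  : ∀ {x y xs as bs c d} → Run xs (as ++ y ∷ bs) c d →
          All (_< x) as → x < y → All (y <_) c →
          Run (x ∷ xs) (as ++ x ∷ bs) (y ∷ c) (false ∷ d)

trues : List Bool → ℕ
trues []          = 0
trues (true ∷ d)  = suc (trues d)
trues (false ∷ d) = trues d

trues≤length : ∀ d → trues d ≤ length d
trues≤length []          = z≤n
trues≤length (true ∷ d)  = s≤s (trues≤length d)
trues≤length (false ∷ d) = m≤n⇒m≤1+n (trues≤length d)

length-replace : ∀ (as : List ℕ) {x y bs} → length (as ++ x ∷ bs) ≡ length (as ++ y ∷ bs)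
length-replace []       = refl
length-replace (a ∷ as) = cong suc (length-replace as)

length-∷ʳ : ∀ (as : List ℕ) {x} → length (as ∷ʳ x) ≡ suc (length as)
length-∷ʳ as {x} = trans (length-++ as) (+-comm (length as) 1)

run-length : ∀ {xs r c d} → Run xs r c d →
  length r ≡ suc (trues d) × length c + trues d ≡ length d
run-length start = refl , refl
run-length (asc {r = r} {c} run _) with run-length run
... | p , q = trans (length-∷ʳ r) (cong suc p) , trans (+-suc (length c) _) (cong suc q)
run-length (desc {as = as} run _ _ _) with run-length run
... | p , q = trans (length-replace as) p , cong suc q

run-↭ : ∀ {xs r c d} → Run xs r c d → xs ↭ r ++ c
run-↭ start = ↭-refl
run-↭ (asc {x} {r = r} {c} run _) = ↭-trans (prep x (run-↭ run))
  (↭-trans (↭-sym (shift x r c)) (subst (λ l → r ++ [ x ] ++ c ↭ l) (sym (++-assoc r [ x ] c)) ↭-refl))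
run-↭ (desc {x} {y} {as = as} {bs} {c} run _ _ _) =
  ↭-trans (prep x (↭-trans (run-↭ run) (++⁺ʳ c (shift y as bs))))
    (↭-trans (swap x y ↭-refl)
      (↭-trans (prep y (++⁺ʳ c (↭-sym (shift x as bs)))) (↭-sym (shift y (as ++ x ∷ bs) c))))

run-∈ : ∀ {xs r c d v} → Run xs r c d → v ∈ xs → v ∈ r ⊎ v ∈ c
run-∈ {r = r} run v∈xs = ∈-++⁻ r (∈-resp-↭ (run-↭ run) v∈xs)

row⊆run : ∀ {xs r c d v} → Run xs r c d → v ∈ r → v ∈ xs
row⊆run run v∈r = ∈-resp-↭ (↭-sym (run-↭ run)) (∈-++⁺ˡ v∈r)

col⊆run : ∀ {xs r c d v} → Run xs r c d → v ∈ c → v ∈ xs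
col⊆run {r = r} run v∈c = ∈-resp-↭ (↭-sym (run-↭ run)) (∈-++⁺ʳ r v∈c)

StrictlySorted : List ℕ → Set
StrictlySorted = AllPairs _<_

run-row-sorted : ∀ {xs r c d} → Run xs r c d → StrictlySorted r
run-row-sorted start = [] ∷ []
run-row-sorted (asc run r<x) = AllPairs.++⁺ (run-row-sorted run) ([] ∷ []) (All.map (_∷ []) r<x)
run-row-sorted (desc {as = as} run as<x x<y _) with AllPairs-++⁻ as (run-row-sorted run)
... | sas , y<bs ∷ sbs , as< = AllPairs.++⁺ sas (All.map (<-trans x<y) y<bs ∷ sbs)
  (All.zipWith (λ { (a<x , _ ∷ a<bs) → a<x ∷ a<bs }) (as<x , as<))

run-col-sorted : ∀ {xs r c d} → Run xs r c d → StrictlySorted c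
run-col-sorted start            = []
run-col-sorted (asc run _)      = run-col-sorted run
run-col-sorted (desc run _ _ p) = p ∷ run-col-sorted run

Corner : List ℕ → List ℕ → Set
Corner r c = ∃ λ h → h ∈ r × All (h <_) c

run-corner : ∀ {xs r c d} → Run xs r c d → Corner r c
run-corner start = _ , here refl , []
run-corner (asc run _) with run-corner run
... | h , h∈r , h<c = h , ∈-++⁺ˡ h∈r , h<c
run-corner (desc {as = as} run _ x<y y<c) =
  _ , ∈-++⁺ʳ as (here refl) , x<y ∷ All.map (<-trans x<y) y<c

-- An entry smaller than the top of the column starts a cascade: each column entry bumps the next,
-- so the whole column moves down by one row.
insert-column : ∀ {y c} → StrictlySorted (y ∷ c) →
  proj₁ (insert y (map [_] c)) ≡ map [_] (y ∷ c)
insert-column {c = []} _ = refl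
insert-column {y} {b ∷ c} ((y<b ∷ _) ∷ ps) with y <? b
... | no  y≮b = contradiction y<b y≮b
... | yes _   = cong ([ y ] ∷_) (insert-column ps)

run-tab : ∀ {xs r c d} → Run xs r c d → tab xs ≡ r ∷ map [_] c
run-tab start = refl
run-tab (asc {x} {r = r} {c} run r<x) rewrite run-tab run
  | insert-∷ x r (map [_] c) | rowInsert-append r<x = refl
run-tab (desc {x} {y} {as = as} {bs} {c} run as<x x<y y<c) rewrite run-tab run
  | insert-∷ x (as ++ y ∷ bs) (map [_] c) | rowInsert-replace {bs = bs} as<x x<y =
  cong (_ ∷_) (insert-column (y<c ∷ run-col-sorted run))

-- An upper bound on the lower rows passes to all earlier stages of the insertion, because shapes
-- only grow.
HookLike : Tableau → Set
HookLike T = All (_≤ 1) (drop 1 (shape T))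

grow-≤1⁻ : ∀ k s → All (_≤ 1) (grow k s) → All (_≤ 1) s
grow-≤1⁻ k       []      ps       = []
grow-≤1⁻ zero    (a ∷ s) (p ∷ ps) = ≤-trans (n≤1+n a) p ∷ ps
grow-≤1⁻ (suc k) (a ∷ s) (p ∷ ps) = p ∷ grow-≤1⁻ k s ps

grow-drop-≤1⁻ : ∀ k s → All (_≤ 1) (drop 1 (grow k s)) → All (_≤ 1) (drop 1 s)
grow-drop-≤1⁻ k       []      ps = []
grow-drop-≤1⁻ zero    (a ∷ s) ps = ps
grow-drop-≤1⁻ (suc k) (a ∷ s) ps = grow-≤1⁻ k s ps

insert-hookLike⁻ : ∀ x T → HookLike (proj₁ (insert x T)) → HookLike T
insert-hookLike⁻ x T hook rewrite shape-insert x T =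
  grow-drop-≤1⁻ (proj₂ (insert x T)) (shape T) hook

-- If `y` were not below the top entry `b`, it would be appended beside `b` and make a row of length
-- two.
insert-column-≤1⁻ : ∀ y c → StrictlySorted c →
  All (_≤ 1) (shape (proj₁ (insert y (map [_] c)))) → All (y <_) c
insert-column-≤1⁻ y [] _ _ = []
insert-column-≤1⁻ y (b ∷ c) (b<c ∷ _) narrow with y <? b
insert-column-≤1⁻ y (b ∷ c) (b<c ∷ _) narrow | yes y<b = y<b ∷ All.map (<-trans y<b) b<c
insert-column-≤1⁻ y (b ∷ c) (b<c ∷ _) (s≤s () ∷ _) | no _

≤∧∉⇒< : ∀ {x r} → All (_≤ x) r → x ∉ r → All (_< x) r
≤∧∉⇒< []       x∉r = []
≤∧∉⇒< (p ∷ ps) x∉r = ≤∧≢⇒< p (λ a≡x → x∉r (here (sym a≡x))) ∷ ≤∧∉⇒< ps (x∉r ∘ there)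

-- The earlier stages are hooks by `insert-hookLike⁻`. At the last one, an entry bumped from the
-- first row has to push down the whole column, which gives the side condition of `desc`.
hookLike⇒run : ∀ x xs → Unique (x ∷ xs) → HookLike (tab (x ∷ xs)) →
  ∃₂ λ r c → ∃ λ d → Run (x ∷ xs) r c d
hookLike⇒run x [] _ _ = _ , _ , _ , start
hookLike⇒run x xs@(z ∷ zs) (x∉xs ∷ u) hook
  with hookLike⇒run z zs u (insert-hookLike⁻ x (tab xs) hook)
... | r , c , d , run
  with subst HookLike (trans (cong (λ T → proj₁ (insert x T)) (run-tab run)) (insert-∷ x r (map [_] c))) hook
     | (λ (x∈r : x ∈ r) → All.lookup x∉xs (row⊆run run x∈r) refl)
... | hook′ | x∉r with rowInsert x r | rowInsertion x r
...   | _ | append r≤x = _ , _ , _ , asc run (≤∧∉⇒< r≤x x∉r)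
...   | _ | replace {as} {y} as≤x x<y = _ , _ , _ ,
  desc run (≤∧∉⇒< as≤x (x∉r ∘ ∈-++⁺ˡ)) x<y
    (insert-column-≤1⁻ y c (run-col-sorted run) hook′)

-- The entry `x` is recovered as the last one below `y`. This is how a bumping step is undone: `x`
-- stands where `y` stood.
separated-≡ : ∀ {y x x′ bs bs′} as as′ →
  All (_< y) as → x < y → All (y <_) bs → All (_< y) as′ → x′ < y → All (y <_) bs′ →
  as ++ x ∷ bs ≡ as′ ++ x′ ∷ bs′ → as ≡ as′ × x ≡ x′ × bs ≡ bs′
separated-≡ [] [] _ _ _ _ _ _ eq = refl , ∷-injective eq
separated-≡ [] (a′ ∷ as′) _ _ y<bs _ x′<y _ refl =
  contradiction x′<y (<-asym (All.lookup y<bs (∈-++⁺ʳ as′ (here refl))))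
separated-≡ (a ∷ as) [] _ x<y _ _ _ y<bs′ refl =
  contradiction x<y (<-asym (All.lookup y<bs′ (∈-++⁺ʳ as (here refl))))
separated-≡ (a ∷ as) (a′ ∷ as′) (_ ∷ p) q r (_ ∷ p′) q′ r′ eq with ∷-injective eq
... | refl , eq′ with separated-≡ as as′ p q r p′ q′ r′ eq′
...   | refl , x≡x′ , bs≡bs′ = refl , x≡x′ , bs≡bs′

-- Reverse insertion is deterministic: the head of `d` tells whether the last entry is found at the
-- end of the row or as the greatest row entry below the top of the column.
run-injective : ∀ {xs ys r r′ c c′ d} → Run xs r c d → Run ys r′ c′ d →
  r ≡ r′ → c ≡ c′ → xs ≡ ys
run-injective start start refl _ = refl
run-injective (asc {r = r} run _) (asc {r = r′} run′ _) r≡r′ c≡c′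
  with ∷ʳ-injective r r′ r≡r′
... | refl , refl = cong (_ ∷_) (run-injective run run′ refl c≡c′)
run-injective (desc {as = as} run as<x x<y _) (desc {as = as′} run′ as′<x′ x′<y _) r≡r′ refl
  with AllPairs-++⁻ as (run-row-sorted run) | AllPairs-++⁻ as′ (run-row-sorted run′)
... | _ , y<bs ∷ _ , _ | _ , y<bs′ ∷ _ , _
  with separated-≡ as as′ (All.map (λ a<x → <-trans a<x x<y) as<x) x<y y<bs
         (All.map (λ a<x → <-trans a<x x′<y) as′<x′) x′<y y<bs′ r≡r′
...   | refl , refl , refl = cong (_ ∷_) (run-injective run run′ refl refl)

separate : ∀ {y} a r → StrictlySorted (a ∷ r) → a < y → y ∉ r →
  ∃₂ λ as x → ∃ λ bs → a ∷ r ≡ as ++ x ∷ bs × All (_< x) as × x < y × All (y <_) bs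
separate a [] _ a<y _ = [] , a , [] , refl , [] , a<y , []
separate {y} a (b ∷ r) (a<br ∷ b<r ∷ sr) a<y y∉r with <-cmp b y
... | tri≈ _ refl _ = contradiction (here refl) y∉r
... | tri> _ _ y<b  = [] , a , b ∷ r , refl , [] , a<y , y<b ∷ All.map (<-trans y<b) b<r
... | tri< b<y _ _ with separate b r (b<r ∷ sr) b<y (y∉r ∘ there)
...   | as , x , bs , eq , as<x , x<y , y<bs rewrite eq =
  a ∷ as , x , bs , refl , All.lookup a<br (∈-++⁺ʳ as (here refl)) ∷ as<x , x<y , y<bs

-- If the witness is the entry `x` being removed, the smaller first entry of the row replaces it.
corner-init : ∀ as {x c n} → All (λ a → All (a <_) (x ∷ [])) as → length as ≡ suc n →
  Corner (as ∷ʳ x) c → Corner as c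
corner-init (a ∷ as) ((a<x ∷ []) ∷ _) _ (h , h∈ , h<c) with ∈-++⁻ (a ∷ as) h∈
... | inj₁ h∈as        = h , h∈as , h<c
... | inj₂ (here refl) = a , here refl , All.map (<-trans a<x) h<c

-- Reverse insertion guided by `d`. A `true` removes the end of the row; a `false` returns the top
-- `y` of the column to the row in place of the greatest row entry below `y`. `Corner` provides such
-- an entry, and afterwards `y` itself is the witness, being below the rest of the column.
run-exists : ∀ d {r c} → StrictlySorted r → StrictlySorted c → Corner r c →
  (∀ {v} → v ∈ r → v ∈ c → ⊥) →
  length r ≡ suc (trues d) → length c + trues d ≡ length d →
  ∃ λ xs → Run xs r c d
run-exists [] {a ∷ []} {[]} _ _ _ _ _ _ = _ , start
run-exists (true ∷ d) {r} {c} sr sc corner disj lr lc with initLast r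
run-exists (true ∷ d) {.(as ∷ʳ x)} {c} sr sc (h , h∈ , h<c) disj lr lc | as ∷ʳ′ x
  with AllPairs-++⁻ as sr | suc-injective (trans (sym (length-∷ʳ as)) lr)
... | sas , _ , as<x | las
  with run-exists d sas sc (corner-init as as<x las (h , h∈ , h<c)) (disj ∘ ∈-++⁺ˡ) las
         (suc-injective (trans (sym (+-suc (length c) (trues d))) lc))
...   | xs , run = x ∷ xs , asc run (All.map All.head as<x)
run-exists (false ∷ d) {r} {[]} sr sc corner disj lr lc =
  -- With an empty column the length equation would make `trues d` exceed `length d`.
  contradiction (trues≤length d) (<⇒≱ (≤-reflexive (sym lc)))
run-exists (false ∷ d) {a ∷ r} {y ∷ c} sr@(a<r ∷ _) (y<c ∷ sc) (h , h∈ , h<y ∷ _) disj lr lc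
  with separate a r sr (≤-<-trans (head≤ h∈) h<y) (λ y∈r → disj (there y∈r) (here refl))
  where
  head≤ : ∀ {h} → h ∈ a ∷ r → a ≤ h
  head≤ (here refl) = ≤-refl
  head≤ (there h∈r) = <⇒≤ (All.lookup a<r h∈r)
... | as , x , bs , eq , as<x , x<y , y<bs with AllPairs-++⁻ as (subst StrictlySorted eq sr)
...   | sas , _ ∷ sbs , as< with run-exists d {as ++ y ∷ bs} {c}
          (AllPairs.++⁺ sas (y<bs ∷ sbs)
            (All.zipWith (λ { (a<x , _ ∷ a<bs) → <-trans a<x x<y ∷ a<bs }) (as<x , as<)))
          sc (y , ∈-++⁺ʳ as (here refl) , y<c) disj′
          (trans (length-replace as) (trans (cong length (sym eq)) lr)) (suc-injective lc)
  where
  disj′ : ∀ {v} → v ∈ as ++ y ∷ bs → v ∈ c → ⊥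
  disj′ v∈ v∈c with ∈-++⁻ as v∈
  ... | inj₁ v∈as         = disj (subst (_ ∈_) (sym eq) (∈-++⁺ˡ v∈as)) (there v∈c)
  ... | inj₂ (here refl)  = <-irrefl refl (All.lookup y<c v∈c)
  ... | inj₂ (there v∈bs) = disj (subst (_ ∈_) (sym eq) (∈-++⁺ʳ as (there v∈bs))) (there v∈c)
...     | xs , run = x ∷ xs ,
  subst (λ l → Run (x ∷ xs) l (y ∷ c) (false ∷ d)) (sym eq) (desc run as<x x<y y<c)

-- Ascents of a hook permutation and of its inverse

ascs : List ℕ → List Bool
ascs []           = []
ascs (_ ∷ [])     = []
ascs (x ∷ y ∷ xs) = does (y <? x) ∷ ascs (y ∷ xs)

length-ascs : ∀ x xs → length (ascs (x ∷ xs)) ≡ length xs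
length-ascs x []       = refl
length-ascs x (y ∷ xs) = cong suc (length-ascs y xs)

-- The bound on `z`, the entry inserted last, is what detects descents. Row entries beyond `z` exist
-- only after a bumping step, and they exceed the entry just bumped, which now tops the column. A
-- row entry below the whole column therefore cannot exceed `z`.
run-last : ∀ {xs r c d} → Run xs r c d → ∃₂ λ z zs → xs ≡ z ∷ zs × z ∈ r ×
  (∀ {v} → v ∈ r → All (v <_) c → v ≤ z)
run-last start = _ , _ , refl , here refl , λ { (here refl) _ → ≤-refl }
run-last (asc {r = r} run r<x) = _ , _ , refl , ∈-++⁺ʳ r (here refl) , bound
  where
  bound : ∀ {v} → v ∈ r ∷ʳ _ → _ → v ≤ _
  bound v∈ _ with ∈-++⁻ r v∈
  ... | inj₁ v∈r         = <⇒≤ (All.lookup r<x v∈r)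
  ... | inj₂ (here refl) = ≤-refl
run-last (desc {x} {y} {as = as} {bs} {c} run as<x _ _) with AllPairs-++⁻ as (run-row-sorted run)
... | _ , y<bs ∷ _ , _ = _ , _ , refl , ∈-++⁺ʳ as (here refl) , bound
  where
  bound : ∀ {v} → v ∈ as ++ x ∷ bs → All (v <_) (y ∷ c) → v ≤ x
  bound v∈ (v<y ∷ _) with ∈-++⁻ as v∈
  ... | inj₁ v∈as         = <⇒≤ (All.lookup as<x v∈as)
  ... | inj₂ (here refl)  = ≤-refl
  ... | inj₂ (there v∈bs) = contradiction v<y (<-asym (All.lookup y<bs v∈bs))

-- An appended entry exceeds the whole row, in which the preceding entry `z` lies. A bumped `y` is
-- below the column, so `run-last` gives `y ≤ z`, and the new `x < y` makes a descent.
run-ascs : ∀ {xs r c d} → Run xs r c d → d ≡ ascs xs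
run-ascs start = refl
run-ascs (asc {x} run r<x) with run-last run
... | z , zs , refl , z∈r , _ =
  cong₂ _∷_ (sym (dec-true (z <? x) (All.lookup r<x z∈r))) (run-ascs run)
run-ascs (desc {x} {as = as} run _ x<y y<c) with run-last run
... | z , zs , refl , _ , v≤z =
  cong₂ _∷_ (sym (dec-false (z <? x) (<-asym (<-≤-trans x<y (v≤z (∈-++⁺ʳ as (here refl)) y<c)))))
    (run-ascs run)

-- Positions count from 1 at the end of the list, where the permutation begins.
data At : List ℕ → ℕ → ℕ → Set where
  here  : ∀ {x xs} → At (x ∷ xs) (suc (length xs)) x
  there : ∀ {x xs i v} → At xs i v → At (x ∷ xs) i v

At-≤ : ∀ {xs i v} → At xs i v → i ≤ length xs
At-≤ here       = ≤-refl
At-≤ (there at) = m≤n⇒m≤1+n (At-≤ at)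

At-> : ∀ {xs i v} → At xs i v → 0 < i
At-> here       = s≤s z≤n
At-> (there at) = At-> at

At-∈ : ∀ {xs i v} → At xs i v → v ∈ xs
At-∈ here       = here refl
At-∈ (there at) = there (At-∈ at)

At-functional : ∀ {xs i v v′} → At xs i v → At xs i v′ → v ≡ v′
At-functional here       here        = refl
At-functional here       (there at′) = contradiction (At-≤ at′) 1+n≰n
At-functional (there at) here        = contradiction (At-≤ at) 1+n≰n
At-functional (there at) (there at′) = At-functional at at′

-- For neighbouring values `a < b` the place of `b` in the tableau records which of the two comes
-- first. It is settled once both are present: by the gap condition, a later insertion never bumps
-- `b` from the row.
run-order : ∀ {xs r c d a b i j} → Unique xs → Run xs r c d →
  At xs i a → At xs j b → a < b → (∀ {v} → v ∈ xs → a < v → v < b → ⊥) →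
  (b ∈ r → i < j) × (b ∈ c → j < i)
run-order u run here here a<b _ = contradiction a<b (<-irrefl refl)
run-order u start here (there ()) _ _
run-order u start (there ()) _ _ _
run-order {b = b} (x∉ ∷ u) (asc {r = r} run′ r<x) here (there at) a<b gap =
  row-case , λ _ → s≤s (At-≤ at)
  where
  row-case : b ∈ r ∷ʳ _ → _
  row-case b∈ with ∈-++⁻ r b∈
  ... | inj₁ b∈r         = contradiction a<b (<-asym (All.lookup r<x b∈r))
  ... | inj₂ (here refl) = contradiction a<b (<-irrefl refl)
run-order {b = b} (x∉ ∷ u) (desc {x} {as = as} {bs} run′ as<x x<y _)
  here (there at) a<b gap =
  row-case , λ _ → s≤s (At-≤ at)
  where
  row-case : b ∈ as ++ x ∷ bs → _
  row-case b∈ with ∈-++⁻ as b∈ | AllPairs-++⁻ as (run-row-sorted run′)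
  ... | inj₁ b∈as | _ = contradiction a<b (<-asym (All.lookup as<x b∈as))
  ... | inj₂ (here refl) | _ = contradiction a<b (<-irrefl refl)
  ... | inj₂ (there b∈bs) | _ , y<bs ∷ _ , _ =
    -- Here `a` is `x`, and the bumped `y` would lie strictly between `a` and `b`.
    ⊥-elim (gap (there (row⊆run run′ (∈-++⁺ʳ as (here refl)))) x<y (All.lookup y<bs b∈bs))
run-order (x∉ ∷ u) (asc run _) (there at) here a<b gap =
  (λ _ → s≤s (At-≤ at)) , λ x∈c → contradiction refl (All.lookup x∉ (col⊆run run x∈c))
run-order {b = b} (x∉ ∷ u) (desc {x} {y} {c = c} run _ x<y _) (there at) here a<b gap =
  (λ _ → s≤s (At-≤ at)) , col-case
  where
  col-case : x ∈ y ∷ c → _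
  col-case (here refl)  = contradiction x<y (<-irrefl refl)
  col-case (there x∈c) = contradiction refl (All.lookup x∉ (col⊆run run x∈c))
run-order {b = b} (x∉ ∷ u) (asc {x} {r = r} run r<x) (there at) (there at′) a<b gap
  with run-order u run at at′ a<b (gap ∘ there)
... | row-order , col-order = row-case , col-order
  where
  row-case : b ∈ r ∷ʳ x → _
  row-case b∈ with ∈-++⁻ r b∈
  ... | inj₁ b∈r         = row-order b∈r
  ... | inj₂ (here refl) = contradiction refl (All.lookup x∉ (At-∈ at′))
run-order {a = a} {b} (x∉ ∷ u) (desc {x} {y} {as = as} {bs} {c} run as<x x<y y<c)
  (there at) (there at′) a<b gap
  with run-order u run at at′ a<b (gap ∘ there)
... | row-order , col-order = row-case , col-case
  where
  row-case : b ∈ as ++ x ∷ bs → _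
  row-case b∈ with ∈-++⁻ as b∈
  ... | inj₁ b∈as         = row-order (∈-++⁺ˡ b∈as)
  ... | inj₂ (here refl)  = contradiction refl (All.lookup x∉ (At-∈ at′))
  ... | inj₂ (there b∈bs) = row-order (∈-++⁺ʳ as (there b∈bs))
  col-case : b ∈ y ∷ c → _
  col-case (there b∈c) = col-order b∈c
  -- Now `b` is the bumped `y`, which cannot happen. As `x` is not between `a` and `b`, it lies
  -- below `a`; but no row entry lies strictly between `x` and the entry it bumps, and every column
  -- entry exceeds `y`.
  col-case (here refl) with <-cmp a x | run-∈ run (At-∈ at)
  ... | tri< a<x _ _ | _ = ⊥-elim (gap (here refl) a<x x<y)
  ... | tri≈ _ refl _ | _ = contradiction refl (All.lookup x∉ (At-∈ at))
  ... | tri> _ _ x<a | inj₂ a∈c = contradiction a<b (<-asym (All.lookup y<c a∈c))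
  ... | tri> _ _ x<a | inj₁ a∈r with ∈-++⁻ as a∈r | AllPairs-++⁻ as (run-row-sorted run)
  ...   | inj₁ a∈as | _ = contradiction x<a (<-asym (All.lookup as<x a∈as))
  ...   | inj₂ (here refl) | _ = contradiction a<b (<-irrefl refl)
  ...   | inj₂ (there a∈bs) | _ , y<bs ∷ _ , _ = contradiction a<b (<-asym (All.lookup y<bs a∈bs))

-- Inverses

-- The invariant of patience sorting: the row entry `a` with 0-based index `i` comes with an
-- increasing subsequence of length `suc i` whose last entry is at most `a`, whence the bound
-- `suc a`.
data RowChains (xs : List ℕ) : ℕ → List ℕ → Set where
  []  : ∀ {i} → RowChains xs i []
  _∷_ : ∀ {i a r} → Chain _<_ (suc a) (suc i) xs → RowChains xs (suc i) r →
        RowChains xs i (a ∷ r)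

rowChains-skip : ∀ {x xs i r} → RowChains xs i r → RowChains (x ∷ xs) i r
rowChains-skip []       = []
rowChains-skip (p ∷ ps) = skip p ∷ rowChains-skip ps

rowChains-append : ∀ {x xs i r} → RowChains xs i r → All (_< x) r →
  Chain _<_ x i xs → RowChains (x ∷ xs) i (r ∷ʳ x)
rowChains-append []       []        c = take ≤-refl c ∷ []
rowChains-append (p ∷ ps) (a<x ∷ q) c = skip p ∷ rowChains-append ps q (Chain-<-mono a<x p)

rowChains-replace : ∀ {x y xs i} as {bs} → RowChains xs i (as ++ y ∷ bs) → All (_< x) as →
  Chain _<_ x i xs → RowChains (x ∷ xs) i (as ++ x ∷ bs)
rowChains-replace []       (_ ∷ ps) []        c = take ≤-refl c ∷ rowChains-skip ps
rowChains-replace (a ∷ as) (p ∷ ps) (a<x ∷ q) c =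
  skip p ∷ rowChains-replace as ps q (Chain-<-mono a<x p)

run-rowChains : ∀ {xs r c d} → Run xs r c d → RowChains xs 0 r
run-rowChains start                        = take ≤-refl done ∷ []
run-rowChains (asc run r<x)                = rowChains-append (run-rowChains run) r<x done
run-rowChains (desc {as = as} run as<x _ _) = rowChains-replace as (run-rowChains run) as<x done

rowChains-length : ∀ {b xs i r} → Chain _<_ b i xs → RowChains xs i r →
  ∃ λ b′ → Chain _<_ b′ (i + length r) xs
rowChains-length {i = i} c [] rewrite +-identityʳ i = _ , c
rowChains-length {i = i} {a ∷ r} _ (p ∷ ps) rewrite +-suc i (length r) = rowChains-length p ps

run-increasing : ∀ {xs r c d} → Run xs r c d → ∃ λ b → Chain _<_ b (length r) xs
run-increasing run = rowChains-length {0} done (run-rowChains run)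

-- Two claims carry each other. When `x` is appended below the column, the chain of column length
-- above `x` comes from the second. When `y` is bumped, the old first claim at `y` gives the new
-- second one, and adding `x` to it gives the new first one.
run-colChains : ∀ {xs r c d} → Run xs r c d →
  (∀ {y b} → y ∈ r → All (y <_) c → b < y → Chain _>_ b (suc (length c)) xs) ×
  (∀ {z c′ b} → c ≡ z ∷ c′ → b < z → Chain _>_ b (length c) xs)
run-colChains start = (λ { (here refl) _ b<y → take b<y done }) , λ ()
run-colChains (asc {x} {xs} {r} {c} run r<x) with run-colChains run
... | from-row , from-col = from-row′ , λ eq b<z → skip (from-col eq b<z)
  where
  below-x : ∀ {c} → (∀ {z c′ b} → c ≡ z ∷ c′ → b < z → Chain _>_ b (length c) xs) →
    All (x <_) c → Chain _>_ x (length c) xs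
  below-x {[]}    _    _         = done
  below-x {z ∷ c} from (x<z ∷ _) = from refl x<z
  from-row′ : ∀ {y b} → y ∈ r ∷ʳ x → All (y <_) c → b < y → Chain _>_ b (suc (length c)) (x ∷ xs)
  from-row′ y∈ y<c b<y with ∈-++⁻ r y∈
  ... | inj₁ y∈r         = skip (from-row y∈r y<c b<y)
  ... | inj₂ (here refl) = take b<y (below-x from-col y<c)
run-colChains (desc {x} {y} {xs} {as} {bs} {c} run as<x x<y y<c) with run-colChains run
... | from-row , _ = from-row′ , λ { refl b<y → skip (from-row (∈-++⁺ʳ as (here refl)) y<c b<y) }
  where
  extend-x : ∀ {b} → b < x → Chain _>_ b (suc (suc (length c))) (x ∷ xs)
  extend-x b<x = take b<x (from-row (∈-++⁺ʳ as (here refl)) y<c x<y)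
  from-row′ : ∀ {v b} → v ∈ as ++ x ∷ bs → All (v <_) (y ∷ c) → b < v →
    Chain _>_ b (suc (suc (length c))) (x ∷ xs)
  from-row′ v∈ (v<y ∷ _) b<v with ∈-++⁻ as v∈ | AllPairs-++⁻ as (run-row-sorted run)
  ... | inj₁ v∈as         | _ = extend-x (<-trans b<v (All.lookup as<x v∈as))
  ... | inj₂ (here refl)  | _ = extend-x b<v
  ... | inj₂ (there v∈bs) | _ , y<bs ∷ _ , _ = contradiction v<y (<-asym (All.lookup y<bs v∈bs))

run-decreasing : ∀ {xs r c d} → All (0 <_) xs → Run xs r c d →
  Chain _>_ 0 (suc (length c)) xs
run-decreasing pos run with run-corner run
... | h , h∈r , h<c = proj₁ (run-colChains run) h∈r h<c (All.lookup pos (row⊆run run h∈r))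

-- A chain seen as a set of points (position, value) of the graph G, so that
-- inverting a permutation amounts to exchanging the coordinates.
data Points (_~_ : ℕ → ℕ → Set) (G : ℕ → ℕ → Set) : ℕ → ℕ → ℕ → Set where
  done : ∀ {k b} → Points _~_ G k b 0
  step : ∀ {k b i v j} → G i v → i < k → v ~ b → Points _~_ G i v j → Points _~_ G k b (suc j)

points-map : ∀ {_~_ G H k b j} → (∀ {i v} → i < k → G i v → H i v) →
  Points _~_ G k b j → Points _~_ H k b j
points-map f done               = done
points-map f (step g i<k v~b p) =
  step (f i<k g) i<k v~b (points-map (λ i′<i → f (<-trans i′<i i<k)) p)

points-mono : ∀ {_~_ G k k′ b j} → k ≤ k′ → Points _~_ G k b j → Points _~_ G k′ b j
points-mono k≤k′ done               = done
points-mono k≤k′ (step g i<k v~b p) = step g (<-≤-trans i<k k≤k′) v~b p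

chain⇒points : ∀ {_~_ b j xs} → Chain _~_ b j xs → Points _~_ (At xs) (suc (length xs)) b j
chain⇒points done         = done
chain⇒points (take x~b c) = step here ≤-refl x~b (points-map (λ _ → there) (chain⇒points c))
chain⇒points (skip c)     = points-mono (n≤1+n _) (points-map (λ _ → there) (chain⇒points c))

points⇒chain : ∀ {_~_ k b j} xs → Points _~_ (At xs) k b j → Chain _~_ b j xs
points⇒chain xs       done                       = done
points⇒chain (x ∷ xs) (step here i<k v~b p)       = take v~b (points⇒chain xs (points-map restrict p))
  where
  restrict : ∀ {i v} → i < suc (length xs) → At (x ∷ xs) i v → At xs i v
  restrict i<k here       = contradiction i<k (<-irrefl refl)
  restrict i<k (there at) = at
points⇒chain (x ∷ xs) (step (there at) i<k v~b p) =
  skip (points⇒chain xs (step at i<k v~b (points-map (restrict (At-≤ at)) p)))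
  where
  restrict : ∀ {i i′ v} → i ≤ length xs → i′ < i → At (x ∷ xs) i′ v → At xs i′ v
  restrict i≤n i′<i here       = contradiction (<-≤-trans i′<i i≤n) (<⇒≱ (s≤s (n≤1+n _)))
  restrict i≤n i′<i (there at) = at

transpose-increasing : ∀ {G k b j} → Points _<_ G k b j → Points _<_ (flip G) b k j
transpose-increasing done               = done
transpose-increasing (step g i<k v<b p) = step g v<b i<k (transpose-increasing p)

-- Exchanging coordinates reverses the order of the points of a decreasing chain, so they are moved
-- one at a time onto `acc`. It is kept for every `i < k` because its bound becomes known only when
-- the next point is moved.
transpose-decreasing : ∀ {G k b j l} → (∀ {i v} → G i v → 0 < i) → 0 < k →
  Points _>_ G k b j → (∀ {i} → i < k → Points _>_ (flip G) (suc b) i l) →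
  ∃ λ b′ → Points _>_ (flip G) b′ 0 (j + l)
transpose-decreasing pos 0<k done acc = _ , acc 0<k
transpose-decreasing {j = suc j} {l} pos 0<k (step g i<k b<v p) acc
  rewrite sym (+-suc j l) = transpose-decreasing pos (pos g) p
    (λ i′<i → step g ≤-refl i′<i (points-mono b<v (acc i<k)))

Transposes : List ℕ → List ℕ → Set
Transposes xs ys = ∀ {i v} → At xs i v → At ys v i

transpose-increasing-chain : ∀ {xs ys b j} → Transposes xs ys → Chain _<_ b j xs →
  ∃ λ b′ → Chain _<_ b′ j ys
transpose-increasing-chain t c =
  _ , points⇒chain _ (points-map (λ _ → t) (transpose-increasing (chain⇒points c)))

transpose-decreasing-chain : ∀ {xs ys b j} → Transposes xs ys → Chain _>_ b j xs →
  Chain _>_ 0 j ys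
transpose-decreasing-chain {j = j} t c
  with transpose-decreasing At-> (s≤s z≤n) (chain⇒points c) (λ _ → done)
... | _ , p rewrite +-identityʳ j = points⇒chain _ (points-map (λ _ → t) p)

-- Hook shape forced by the lengths of two chains

sum-grow : ∀ k s → sum (grow k s) ≡ suc (sum s)
sum-grow k       []      = refl
sum-grow zero    (a ∷ s) = refl
sum-grow (suc k) (a ∷ s) = trans (cong (a +_) (sum-grow k s)) (+-suc a (sum s))

grow-positive : ∀ k {s} → All (1 ≤_) s → All (1 ≤_) (grow k s)
grow-positive k       []       = ≤-refl ∷ []
grow-positive zero    (p ∷ ps) = s≤s z≤n ∷ ps
grow-positive (suc k) (p ∷ ps) = p ∷ grow-positive k ps

tab-size : ∀ xs → sum (shape (tab xs)) ≡ length xs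
tab-size []       = refl
tab-size (x ∷ xs) rewrite shape-insert x (tab xs) =
  trans (sum-grow _ (shape (tab xs))) (cong suc (tab-size xs))

tab-positive : ∀ xs → All (1 ≤_) (shape (tab xs))
tab-positive []       = []
tab-positive (x ∷ xs) rewrite shape-insert x (tab xs) = grow-positive _ (tab-positive xs)

length≤sum : ∀ {s} → All (1 ≤_) s → length s ≤ sum s
length≤sum []       = z≤n
length≤sum (p ∷ ps) = +-mono-≤ p (length≤sum ps)

sum≤length⇒≤1 : ∀ {s} → All (1 ≤_) s → sum s ≤ length s → All (_≤ 1) s
sum≤length⇒≤1 [] _ = []
sum≤length⇒≤1 {a ∷ s} (p ∷ ps) le =
  +-cancelʳ-≤ (length s) a 1 (≤-trans (+-monoʳ-≤ a (length≤sum ps)) le) ∷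
  sum≤length⇒≤1 ps (+-cancelˡ-≤ 1 (sum s) (length s) (≤-trans (+-monoˡ-≤ (sum s) p) le))

-- Positive rows give `length s ≤ sum s`, so the lower bounds already add up to the total and all
-- the inequalities are equalities.
hook-squeeze : ∀ {k m a s} → k ≤ a → m ≤ length s → All (1 ≤_) s → a + sum s ≡ k + m →
  a ≡ k × All (_≤ 1) s
hook-squeeze {k} {m} {a} {s} k≤a m≤s ps eq =
  ≤-antisym (+-cancelʳ-≤ m a k (≤-trans (+-monoʳ-≤ a m≤sum) (≤-reflexive eq))) k≤a ,
  sum≤length⇒≤1 ps (≤-trans (+-cancelˡ-≤ k (sum s) m
    (≤-trans (+-monoˡ-≤ (sum s) k≤a) (≤-reflexive eq))) m≤s)
  where
  m≤sum : m ≤ sum s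
  m≤sum = ≤-trans m≤s (length≤sum ps)

-- Chains of lengths `length r` and `suc (length c)` pass to `ys` and bound its first row and its
-- number of rows from below. Since `length r + length c` is the number of cells, the squeeze leaves
-- only the same hook.
run-transpose : ∀ {xs ys r c d} → All (0 <_) xs → Unique ys → length ys ≡ length xs →
  Transposes xs ys → Run xs r c d →
  ∃₂ λ r′ c′ → (∃ λ d′ → Run ys r′ c′ d′) × length r′ ≡ length r
run-transpose {[]} _ _ _ _ ()
run-transpose {xs@(_ ∷ _)} {[]} _ _ ()
run-transpose {xs@(_ ∷ _)} {ys@(y ∷ ys′)} {r} {c} pos u len t run
  with transpose-increasing-chain t (run-increasing run .proj₂)
     | transpose-decreasing-chain t (run-decreasing pos run)
... | _ , inc | dec
  with subst (λ T → suc (length c) ≤ length T) (tab-∷ y ys′) (chain≤rows (suc (length c)) ys dec)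
     | subst (λ T → All (1 ≤_) (shape T)) (tab-∷ y ys′) (tab-positive ys)
... | s≤s rows | _ ∷ pos′
  with hook-squeeze (chain≤row {xs = ys} inc)
         (≤-trans rows (≤-reflexive (sym (length-map length (tab (bumped ys))))))
         pos′
         (trans (sym (cong (sum ∘ shape) (tab-∷ y ys′)))
           (trans (tab-size ys) (trans len (trans (↭-length (run-↭ run)) (length-++ r)))))
... | row≡ , narrow
  with hookLike⇒run y ys′ u (subst HookLike (sym (tab-∷ y ys′)) narrow)
... | r′ , c′ , d′ , run′ = r′ , c′ , (d′ , run′) ,
  trans (cong length (proj₁ (∷-injective (trans (sym (run-tab run′)) (tab-∷ y ys′))))) row≡

-- The code of a hook permutation

run-disjoint : ∀ {xs r c d v} → Unique xs → Run xs r c d → v ∈ r → v ∈ c → ⊥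
run-disjoint (x∉ ∷ u) (asc {r = r} run _) v∈ v∈c with ∈-++⁻ r v∈
... | inj₁ v∈r         = run-disjoint u run v∈r v∈c
... | inj₂ (here refl) = All.lookup x∉ (col⊆run run v∈c) refl
run-disjoint (x∉ ∷ u) (desc {as = as} run as<x x<y _) v∈ (here refl)
  with ∈-++⁻ as v∈ | AllPairs-++⁻ as (run-row-sorted run)
... | inj₁ v∈as         | _                 = <-asym x<y (All.lookup as<x v∈as)
... | inj₂ (here refl)  | _                 = <-irrefl refl x<y
... | inj₂ (there v∈bs) | _ , y<bs ∷ _ , _ = <-irrefl refl (All.lookup y<bs v∈bs)
run-disjoint (x∉ ∷ u) (desc {as = as} run _ _ _) v∈ (there v∈c) with ∈-++⁻ as v∈
... | inj₁ v∈as         = run-disjoint u run (∈-++⁺ˡ v∈as) v∈c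
... | inj₂ (here refl)  = All.lookup x∉ (col⊆run run v∈c) refl
... | inj₂ (there v∈bs) = run-disjoint u run (∈-++⁺ʳ as (there v∈bs)) v∈c

-- Places r c e: the word e, read from its end, tells for 2, 3, … in turn
-- whether the entry is in r or in c.
data Places (r c : List ℕ) : List Bool → Set where
  []    : Places r c []
  inRow : ∀ {e} → 2 + length e ∈ r → Places r c e → Places r c (true ∷ e)
  inCol : ∀ {e} → 2 + length e ∈ c → Places r c e → Places r c (false ∷ e)

-- The entries of the inverse are positions in `xs`, so its ascents compare the positions of
-- consecutive values, as `run-order` does. `Transposes` is a one-way inclusion, hence it survives
-- dropping the head of the inverse in the recursion.
run-places : ∀ {xs r c d} → Unique xs → Run xs r c d → ∀ y ys →
  Transposes (y ∷ ys) xs → Places r c (ascs (y ∷ ys))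
run-places u run y []       t = []
run-places {r = r} {c} u run y (z ∷ ys) t
  with run-order u run (t (there here)) (t here) ≤-refl
         (λ _ a<v v<1+a → <-irrefl refl (<-≤-trans a<v (s≤s⁻¹ v<1+a)))
     | run-∈ run (At-∈ (t here))
     | run-places u run z ys (t ∘ there)
... | row-order , _ | inj₁ ∈r | p =
  subst (λ b → Places r c (b ∷ ascs (z ∷ ys))) (sym (dec-true (z <? y) (row-order ∈r)))
    (inRow (subst (λ k → 2 + k ∈ r) (sym (length-ascs z ys)) ∈r) p)
... | _ , col-order | inj₂ ∈c | p =
  subst (λ b → Places r c (b ∷ ascs (z ∷ ys))) (sym (dec-false (z <? y) (<-asym (col-order ∈c))))
    (inCol (subst (λ k → 2 + k ∈ c) (sym (length-ascs z ys)) ∈c) p)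

places-⊆ : ∀ {r r′ c c′ e v} → (∀ {v} → v ∈ r → v ∈ c → ⊥) →
  Places r c e → Places r′ c′ e → 2 ≤ v → v ≤ suc (length e) →
  (v ∈ r → v ∈ r′) × (v ∈ c → v ∈ c′)
places-⊆ disj [] [] 2≤v v≤1 = contradiction (≤-trans 2≤v v≤1) (λ { (s≤s ()) })
places-⊆ disj (inRow k∈r p) (inRow k∈r′ p′) 2≤v v≤k with m≤n⇒m<n∨m≡n v≤k
... | inj₁ v<k  = places-⊆ disj p p′ 2≤v (s≤s⁻¹ v<k)
... | inj₂ refl = (λ _ → k∈r′) , λ v∈c → ⊥-elim (disj k∈r v∈c)
places-⊆ disj (inCol k∈c p) (inCol k∈c′ p′) 2≤v v≤k with m≤n⇒m<n∨m≡n v≤k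
... | inj₁ v<k  = places-⊆ disj p p′ 2≤v (s≤s⁻¹ v<k)
... | inj₂ refl = (λ v∈r → ⊥-elim (disj v∈r k∈c)) , λ _ → k∈c′

places-functional : ∀ {r c e e′} → (∀ {v} → v ∈ r → v ∈ c → ⊥) → length e ≡ length e′ →
  Places r c e → Places r c e′ → e ≡ e′
places-functional disj eq [] [] = refl
places-functional disj eq (inRow _ p) (inRow _ p′) =
  cong (true ∷_) (places-functional disj (suc-injective eq) p p′)
places-functional disj eq (inCol _ p) (inCol _ p′) =
  cong (false ∷_) (places-functional disj (suc-injective eq) p p′)
places-functional {r} disj eq (inRow k∈r _) (inCol k∈c _) =
  ⊥-elim (disj (subst (λ k → suc k ∈ r) eq k∈r) k∈c)
places-functional {c = c} disj eq (inCol k∈c _) (inRow k∈r _) =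
  ⊥-elim (disj k∈r (subst (λ k → suc k ∈ c) eq k∈c))

places-mono : ∀ {r r′ c c′ e} → (∀ {v} → v ∈ r → v ∈ r′) → (∀ {v} → v ∈ c → v ∈ c′) →
  Places r c e → Places r′ c′ e
places-mono f g []          = []
places-mono f g (inRow k p) = inRow (f k) (places-mono f g p)
places-mono f g (inCol k p) = inCol (g k) (places-mono f g p)

sorted-≡ : ∀ {as bs} → StrictlySorted as → StrictlySorted bs →
  (∀ {v} → v ∈ as → v ∈ bs) → (∀ {v} → v ∈ bs → v ∈ as) → as ≡ bs
sorted-≡ [] []      f g = refl
sorted-≡ [] (_ ∷ _) f g with () ← g (here refl)
sorted-≡ (_ ∷ _) [] f g with () ← f (here refl)
sorted-≡ {a ∷ as} {b ∷ bs} (a<as ∷ sas) (b<bs ∷ sbs) f g =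
  cong₂ _∷_ a≡b (sorted-≡ sas sbs (tail⊆ a<as a≡b f) (tail⊆ b<bs (sym a≡b) g))
  where
  a≡b : a ≡ b
  a≡b with f (here refl) | g (here refl)
  ... | here eq    | _           = eq
  ... | there _    | here eq     = sym eq
  ... | there a∈bs | there b∈as =
    contradiction (All.lookup a<as b∈as) (<-asym (All.lookup b<bs a∈bs))
  tail⊆ : ∀ {x y xs ys} → All (x <_) xs → x ≡ y →
    (∀ {v} → v ∈ x ∷ xs → v ∈ y ∷ ys) → ∀ {v} → v ∈ xs → v ∈ ys
  tail⊆ x<xs refl h v∈xs with h (there v∈xs)
  ... | here refl  = contradiction (All.lookup x<xs v∈xs) (<-irrefl refl)
  ... | there v∈ys = v∈ys

record IsPermutationList (n : ℕ) (xs : List ℕ) : Set where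
  field
    unique   : Unique xs
    bounded  : ∀ {v} → v ∈ xs → 1 ≤ v × v ≤ n
    complete : ∀ {v} → 1 ≤ v → v ≤ n → v ∈ xs
open IsPermutationList

-- A column containing 1 would need a corner entry below 1. This is why codes start at the value 2.
one∈row : ∀ {n xs r c d} → IsPermutationList (suc n) xs → Run xs r c d → 1 ∈ r
one∈row perm run with run-corner run | run-∈ run (complete perm ≤-refl (s≤s z≤n))
... | _ | inj₁ 1∈r = 1∈r
... | h , h∈r , h<c | inj₂ 1∈c =
  contradiction (All.lookup h<c 1∈c) (≤⇒≯ (proj₁ (bounded perm (row⊆run run h∈r))))

run-⊆ : ∀ {n xs xs′ r r′ c c′ d d′ e} → length e ≡ n →
  IsPermutationList (suc n) xs → IsPermutationList (suc n) xs′ →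
  Run xs r c d → Run xs′ r′ c′ d′ → Places r c e → Places r′ c′ e →
  (∀ {v} → v ∈ r → v ∈ r′) × (∀ {v} → v ∈ c → v ∈ c′)
run-⊆ {r = r} {r′} {c} {c′} refl perm perm′ run run′ p p′ = row-case , col-case
  where
  disj : ∀ {v} → v ∈ r → v ∈ c → ⊥
  disj = run-disjoint (unique perm) run
  row-case : ∀ {v} → v ∈ r → v ∈ r′
  row-case v∈r with bounded perm (row⊆run run v∈r)
  ... | 1≤v , v≤n with m≤n⇒m<n∨m≡n 1≤v
  ...   | inj₁ 2≤v  = proj₁ (places-⊆ disj p p′ 2≤v v≤n) v∈r
  ...   | inj₂ refl = one∈row perm′ run′
  col-case : ∀ {v} → v ∈ c → v ∈ c′
  col-case v∈c with bounded perm (col⊆run run v∈c)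
  ... | 1≤v , v≤n with m≤n⇒m<n∨m≡n 1≤v
  ...   | inj₁ 2≤v  = proj₂ (places-⊆ disj p p′ 2≤v v≤n) v∈c
  ...   | inj₂ refl = ⊥-elim (disj (one∈row perm run) v∈c)

-- The word `e` fixes the sets of row and column entries, sortedness fixes the tableau, and reverse
-- insertion along `d` fixes the permutation.
run-determined : ∀ {n xs xs′ r r′ c c′ d e} → length e ≡ n →
  IsPermutationList (suc n) xs → IsPermutationList (suc n) xs′ →
  Run xs r c d → Run xs′ r′ c′ d → Places r c e → Places r′ c′ e → xs ≡ xs′
run-determined len perm perm′ run run′ p p′
  with run-⊆ len perm perm′ run run′ p p′ | run-⊆ len perm′ perm run′ run p′ p
... | r⊆ , c⊆ | r⊇ , c⊇ = run-injective run run′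
  (sorted-≡ (run-row-sorted run) (run-row-sorted run′) r⊆ r⊇)
  (sorted-≡ (run-col-sorted run) (run-col-sorted run′) c⊆ c⊇)

-- Realising every pair of codes

rowOf colOf : List Bool → List ℕ
rowOf []          = [ 1 ]
rowOf (true ∷ e)  = rowOf e ∷ʳ (2 + length e)
rowOf (false ∷ e) = rowOf e
colOf []          = []
colOf (true ∷ e)  = colOf e
colOf (false ∷ e) = colOf e ∷ʳ (2 + length e)

places-of : ∀ e → Places (rowOf e) (colOf e) e
places-of []          = []
places-of (true ∷ e)  = inRow (∈-++⁺ʳ (rowOf e) (here refl)) (places-mono ∈-++⁺ˡ id (places-of e))
places-of (false ∷ e) = inCol (∈-++⁺ʳ (colOf e) (here refl)) (places-mono id ∈-++⁺ˡ (places-of e))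

oneTo : ℕ → List ℕ
oneTo n = map suc (downFrom n)

rowOf-colOf-↭ : ∀ e → rowOf e ++ colOf e ↭ oneTo (suc (length e))
rowOf-colOf-↭ []          = ↭-refl
rowOf-colOf-↭ (true ∷ e)
  rewrite ++-assoc (rowOf e) [ 2 + length e ] (colOf e) =
  ↭-trans (shift _ (rowOf e) (colOf e)) (prep _ (rowOf-colOf-↭ e))
rowOf-colOf-↭ (false ∷ e)
  rewrite sym (++-assoc (rowOf e) (colOf e) [ 2 + length e ]) =
  ↭-trans (↭-sym (∷↭∷ʳ _ (rowOf e ++ colOf e))) (prep _ (rowOf-colOf-↭ e))

rowOf-≤ : ∀ e → All (_≤ suc (length e)) (rowOf e)
rowOf-≤ []          = ≤-refl ∷ []
rowOf-≤ (true ∷ e)  = All.++⁺ (All.map m≤n⇒m≤1+n (rowOf-≤ e)) (≤-refl ∷ [])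
rowOf-≤ (false ∷ e) = All.map m≤n⇒m≤1+n (rowOf-≤ e)

colOf-≤ : ∀ e → All (_≤ suc (length e)) (colOf e)
colOf-≤ []          = []
colOf-≤ (true ∷ e)  = All.map m≤n⇒m≤1+n (colOf-≤ e)
colOf-≤ (false ∷ e) = All.++⁺ (All.map m≤n⇒m≤1+n (colOf-≤ e)) (≤-refl ∷ [])

sorted-∷ʳ : ∀ {as x} → StrictlySorted as → All (_< x) as → StrictlySorted (as ∷ʳ x)
sorted-∷ʳ sas as<x = AllPairs.++⁺ sas ([] ∷ []) (All.map (_∷ []) as<x)

rowOf-sorted : ∀ e → StrictlySorted (rowOf e)
rowOf-sorted []          = [] ∷ []
rowOf-sorted (true ∷ e)  = sorted-∷ʳ (rowOf-sorted e) (All.map s≤s (rowOf-≤ e))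
rowOf-sorted (false ∷ e) = rowOf-sorted e

colOf-sorted : ∀ e → StrictlySorted (colOf e)
colOf-sorted []          = []
colOf-sorted (true ∷ e)  = colOf-sorted e
colOf-sorted (false ∷ e) = sorted-∷ʳ (colOf-sorted e) (All.map s≤s (colOf-≤ e))

corner-of : ∀ e → Corner (rowOf e) (colOf e)
corner-of []          = 1 , here refl , []
corner-of (true ∷ e)  with corner-of e
... | h , h∈ , h< = h , ∈-++⁺ˡ h∈ , h<
corner-of (false ∷ e) with corner-of e
... | h , h∈ , h< = h , h∈ , All.++⁺ h< (s≤s (All.lookup (rowOf-≤ e) h∈) ∷ [])

rowOf-colOf-disjoint : ∀ e {v} → v ∈ rowOf e → v ∈ colOf e → ⊥
rowOf-colOf-disjoint (true ∷ e) v∈r v∈c with ∈-++⁻ (rowOf e) v∈r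
... | inj₁ v∈         = rowOf-colOf-disjoint e v∈ v∈c
... | inj₂ (here refl) = 1+n≰n (All.lookup (colOf-≤ e) v∈c)
rowOf-colOf-disjoint (false ∷ e) v∈r v∈c with ∈-++⁻ (colOf e) v∈c
... | inj₁ v∈         = rowOf-colOf-disjoint e v∈r v∈
... | inj₂ (here refl) = 1+n≰n (All.lookup (rowOf-≤ e) v∈r)

length-rowOf : ∀ e → length (rowOf e) ≡ suc (trues e)
length-rowOf []          = refl
length-rowOf (true ∷ e)  = trans (length-∷ʳ (rowOf e)) (cong suc (length-rowOf e))
length-rowOf (false ∷ e) = length-rowOf e

length-colOf : ∀ e → length (colOf e) + trues e ≡ length e
length-colOf []          = refl
length-colOf (true ∷ e)  = trans (+-suc (length (colOf e)) (trues e)) (cong suc (length-colOf e))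
length-colOf (false ∷ e) rewrite length-∷ʳ (colOf e) {2 + length e} = cong suc (length-colOf e)

-- The two equalities say that the recording tableau coded by `d` and the insertion tableau coded by
-- `e` have the same hook shape.
permutationList-exists : ∀ d e → length d ≡ length e → trues d ≡ trues e →
  ∃ λ xs → IsPermutationList (suc (length e)) xs × Run xs (rowOf e) (colOf e) d
permutationList-exists d e len tr
  with run-exists d (rowOf-sorted e) (colOf-sorted e) (corner-of e) (rowOf-colOf-disjoint e)
         (trans (length-rowOf e) (cong suc (sym tr)))
         (trans (cong (length (colOf e) +_) tr) (trans (length-colOf e) (sym len)))
... | xs , run = xs , record
  { unique   = Unique-resp-↭ (↭⇒↭ₛ (↭-sym xs↭)) (Unique.map⁺ suc-injective (Unique.downFrom⁺ _))
  ; bounded  = bounded′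
  ; complete = complete′
  } , run
  where
  n = suc (length e)
  xs↭ : xs ↭ oneTo n
  xs↭ = ↭-trans (run-↭ run) (rowOf-colOf-↭ e)
  bounded′ : ∀ {v} → v ∈ xs → 1 ≤ v × v ≤ n
  bounded′ v∈ with ∈-map⁻ suc (∈-resp-↭ xs↭ v∈)
  ... | u , u∈ , refl = s≤s z≤n , ∈-downFrom⁻ u∈
  complete′ : ∀ {v} → 1 ≤ v → v ≤ n → v ∈ xs
  complete′ {suc v} _ v<n = ∈-resp-↭ (↭-sym xs↭) (∈-map⁺ suc (∈-downFrom⁺ v<n))

-- Longest increasing subsequences

[]∈subsequences : ∀ (us : List ℕ) → [] ∈ subsequences us
[]∈subsequences []       = here refl
[]∈subsequences (u ∷ us) = ∈-++⁺ʳ _ ([]∈subsequences us)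

subsequences-All : ∀ {P : ℕ → Set} us {ys} → All P us → ys ∈ subsequences us → All P ys
subsequences-All []       _        (here refl) = []
subsequences-All (u ∷ us) (p ∷ ps) ys∈ with ∈-++⁻ (map (u ∷_) (subsequences us)) ys∈
... | inj₂ ys∈′ = subsequences-All us ps ys∈′
... | inj₁ uys∈ with ∈-map⁻ (u ∷_) uys∈
...   | _ , ys∈′ , refl = p ∷ subsequences-All us ps ys∈′

chain⇒subsequence : ∀ {b j us} → Chain _>_ b j us →
  ∃ λ ys → ys ∈ subsequences us × Linked _<_ (b ∷ ys) × length ys ≡ j
chain⇒subsequence {us = us} done = [] , []∈subsequences us , [-] , refl
chain⇒subsequence (take {x = x} b<x c) with chain⇒subsequence c
... | ys , ys∈ , ly , refl = x ∷ ys , ∈-++⁺ˡ (∈-map⁺ (x ∷_) ys∈) , b<x ∷ ly , refl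
chain⇒subsequence (skip c) with chain⇒subsequence c
... | ys , ys∈ , ly , eq = ys , ∈-++⁺ʳ _ ys∈ , ly , eq

subsequence⇒chain : ∀ {b} us {ys} → ys ∈ subsequences us → Linked _<_ (b ∷ ys) →
  Chain _>_ b (length ys) us
subsequence⇒chain []       (here refl) _  = done
subsequence⇒chain (u ∷ us) ys∈         ly with ∈-++⁻ (map (u ∷_) (subsequences us)) ys∈
... | inj₂ ys∈′ = skip (subsequence⇒chain us ys∈′ ly)
... | inj₁ uys∈ with ∈-map⁻ (u ∷_) uys∈
subsequence⇒chain (u ∷ us) ys∈ (b<u ∷ ly) | inj₁ uys∈ | _ , ys∈′ , refl =
  take b<u (subsequence⇒chain us ys∈′ ly)

-- Subsequences in the definition of `lis` are read forwards, from the smallest entry up, while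
-- `Chain _<_` starts from the largest. Reversal with an accumulator turns one reading into the
-- other.
chain-ʳ++ : ∀ {b j l zs} us → Chain _>_ b j us → Chain _<_ (suc b) l zs →
  ∃ λ b′ → Chain _<_ b′ (j + l) (us ʳ++ zs)
chain-ʳ++ []       done       acc = _ , acc
chain-ʳ++ (u ∷ us) done       acc = chain-ʳ++ us done (skip acc)
chain-ʳ++ (u ∷ us) (skip c)   acc = chain-ʳ++ us c (skip acc)
chain-ʳ++ {j = suc j} {l} (u ∷ us) (take b<u c) acc rewrite sym (+-suc j l) =
  chain-ʳ++ us c (take ≤-refl (Chain-<-mono b<u acc))

chain-ʳ++⁻ : ∀ {b j l zs} us → All (0 <_) us → 0 < b → Chain _<_ b j us →
  (∀ {v} → v < b → Chain _>_ v l zs) → Chain _>_ 0 (j + l) (us ʳ++ zs)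
chain-ʳ++⁻ []       _        0<b done       acc = acc 0<b
chain-ʳ++⁻ (u ∷ us) (_ ∷ ps) 0<b done       acc = chain-ʳ++⁻ us ps 0<b done (skip ∘ acc)
chain-ʳ++⁻ (u ∷ us) (_ ∷ ps) 0<b (skip c)   acc = chain-ʳ++⁻ us ps 0<b c (skip ∘ acc)
chain-ʳ++⁻ {j = suc j} {l} (u ∷ us) (0<u ∷ ps) 0<b (take u<b c) acc rewrite sym (+-suc j l) =
  chain-ʳ++⁻ us ps 0<u c (λ v<u → take v<u (acc u<b))

run-lis : ∀ {us r c d} → All (0 <_) us → Run (reverse us) r c d → lis us ≡ length r
run-lis {us} {r} {c} pos run = ≤-antisym (max≤v⁺ z≤n (All.tabulate upper)) lower
  where
  increasing? = linked? _<?_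
  row≡ : row (reverse us) ≡ r
  row≡ with reverse us | run-last run | run-tab run
  ... | _ | z , zs , refl , _ | eq = proj₁ (∷-injective (trans (sym (tab-∷ z zs)) eq))
  upper : ∀ {k} → k ∈ map length (filter increasing? (subsequences us)) → k ≤ length r
  upper k∈ with ∈-map⁻ length k∈
  ... | ys , ys∈ , refl with ∈-filter⁻ increasing? ys∈
  ...   | ys∈′ , ly with chain-ʳ++ us
    (subsequence⇒chain us ys∈′ (positive (subsequences-All us pos ys∈′) ly)) done
    where
    positive : ∀ {ys} → All (0 <_) ys → Linked _<_ ys → Linked _<_ (0 ∷ ys)
    positive []      []  = [-]
    positive (p ∷ _) ly  = p ∷ ly
  ...     | _ , ch rewrite +-identityʳ (length ys) =
    subst (λ l → length ys ≤ length l) row≡ (chain≤row {xs = reverse us} ch)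
  lower : length r ≤ lis us
  lower with run-increasing run
  ... | b , ch with chain⇒subsequence (subst (Chain _>_ 0 _) (reverse-involutive us)
    -- Reversal starts from a positive bound, so `b` is raised to `suc b`.
    (chain-ʳ++⁻ {l = 0} (reverse us) (All-resp-↭ (↭-sym (↭-reverse us)) pos) (s≤s (z≤n {b}))
      (Chain-<-mono (n≤1+n b) ch) (λ _ → done)))
  ...   | ys , ys∈ , ly , eq = v≤max⁺ 0 _ (inj₂
    (Any.map (λ { refl → ≤-reflexive (trans (sym (+-identityʳ _)) (sym eq)) })
      (∈-map⁺ length (∈-filter⁺ increasing? ys∈ (Linked.tail ly)))))

-- Binary words, binomial coefficients and log concavity

binaryWords : ℕ → ℕ → List (List Bool)
binaryWords zero    zero    = [] ∷ []
binaryWords zero    (suc k) = []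
binaryWords (suc m) zero    = map (false ∷_) (binaryWords m zero)
binaryWords (suc m) (suc k) =
  map (true ∷_) (binaryWords m k) ++ map (false ∷_) (binaryWords m (suc k))

∈-binaryWords⁺ : ∀ d → d ∈ binaryWords (length d) (trues d)
∈-binaryWords⁺ []         = here refl
∈-binaryWords⁺ (true ∷ d) = ∈-++⁺ˡ (∈-map⁺ (true ∷_) (∈-binaryWords⁺ d))
∈-binaryWords⁺ (false ∷ d) with trues d | ∈-binaryWords⁺ d
... | zero  | d∈ = ∈-map⁺ (false ∷_) d∈
... | suc _ | d∈ = ∈-++⁺ʳ _ (∈-map⁺ (false ∷_) d∈)

∈-binaryWords⁻ : ∀ m k {d} → d ∈ binaryWords m k → length d ≡ m × trues d ≡ k
∈-binaryWords⁻ zero    zero (here refl) = refl , refl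
∈-binaryWords⁻ (suc m) zero d∈ with ∈-map⁻ (false ∷_) d∈
... | d , d∈′ , refl with ∈-binaryWords⁻ m zero d∈′
...   | refl , eq = refl , eq
∈-binaryWords⁻ (suc m) (suc k) d∈ with ∈-++⁻ (map (true ∷_) (binaryWords m k)) d∈
... | inj₁ td∈ with ∈-map⁻ (true ∷_) td∈
...   | d , d∈′ , refl with ∈-binaryWords⁻ m k d∈′
...     | refl , refl = refl , refl
∈-binaryWords⁻ (suc m) (suc k) d∈ | inj₂ fd∈ with ∈-map⁻ (false ∷_) fd∈
...   | d , d∈′ , refl with ∈-binaryWords⁻ m (suc k) d∈′
...     | refl , eq = refl , eq

binaryWords-unique : ∀ m k → Unique (binaryWords m k)
binaryWords-unique zero    zero    = [] ∷ []
binaryWords-unique zero    (suc k) = []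
binaryWords-unique (suc m) zero    = Unique.map⁺ (proj₂ ∘ ∷-injective) (binaryWords-unique m zero)
binaryWords-unique (suc m) (suc k) = Unique.++⁺
  (Unique.map⁺ (proj₂ ∘ ∷-injective) (binaryWords-unique m k))
  (Unique.map⁺ (proj₂ ∘ ∷-injective) (binaryWords-unique m (suc k)))
  λ { (t∈ , f∈) → true≢false (∈-map⁻ _ t∈) (∈-map⁻ _ f∈) }
  where
  true≢false : ∀ {d : List Bool} {ds es} → (∃ λ d′ → d′ ∈ ds × d ≡ true ∷ d′) →
    (∃ λ d′ → d′ ∈ es × d ≡ false ∷ d′) → ⊥
  true≢false (_ , _ , refl) (_ , _ , ())

length-binaryWords : ∀ m k → length (binaryWords m k) ≡ m C k
length-binaryWords zero    zero    = refl
length-binaryWords zero    (suc k) = refl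
length-binaryWords (suc m) zero    =
  trans (length-map _ (binaryWords m zero)) (length-binaryWords m zero)
length-binaryWords (suc m) (suc k) = trans
  (trans (length-++ (map (true ∷_) (binaryWords m k)))
    (cong₂ _+_ (trans (length-map _ (binaryWords m k)) (length-binaryWords m k))
               (trans (length-map _ (binaryWords m (suc k))) (length-binaryWords m (suc k)))))
  (nCk+nC[k+1]≡[n+1]C[k+1] m k)

-- The inequality between neighbours alone is not inherited along Pascal's
-- recursion; this spread-out form is.
C-spread : ∀ m r s → r ≤ s → (m C r) * (m C suc s) ≤ (m C suc r) * (m C s)
C-spread m r s r≤s with m≤n⇒m<n∨m≡n r≤s
C-spread m r s r≤s | inj₂ refl = ≤-reflexive (*-comm (m C r) (m C suc r))
C-spread zero    r s r≤s | inj₁ (s≤s _) = ≤-trans (≤-reflexive (*-zeroʳ (0 C r))) z≤n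
C-spread (suc m) zero (suc s) r≤s | inj₁ _
  rewrite sym (nCk+nC[k+1]≡[n+1]C[k+1] m (suc s)) | sym (nCk+nC[k+1]≡[n+1]C[k+1] m s)
        | sym (nCk+nC[k+1]≡[n+1]C[k+1] m 0) = begin
  1 * (x₁ + x₂) ≡⟨ *-identityˡ _ ⟩
  x₁ + x₂ ≤⟨ +-monoʳ-≤ x₁ (≤-trans (≤-reflexive (sym (*-identityˡ x₂))) (C-spread m 0 (suc s) z≤n)) ⟩
  x₁ + y * x₁ ≡⟨⟩
  suc y * x₁ ≤⟨ *-monoʳ-≤ (suc y) (m≤n+m x₁ (m C s)) ⟩
  suc y * (m C s + x₁) ∎
  where
  open ≤-Reasoning
  x₁ x₂ y : ℕ
  x₁ = m C suc s
  x₂ = m C suc (suc s)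
  y  = m C 1
C-spread (suc m) (suc r) (suc s) r≤s | inj₁ (s≤s r<s)
  rewrite sym (nCk+nC[k+1]≡[n+1]C[k+1] m (suc s)) | sym (nCk+nC[k+1]≡[n+1]C[k+1] m s)
        | sym (nCk+nC[k+1]≡[n+1]C[k+1] m r) | sym (nCk+nC[k+1]≡[n+1]C[k+1] m (suc r)) = begin
  (x₀ + x₁) * (y₁ + y₂)                     ≡⟨ expand x₀ x₁ y₁ y₂ ⟩
  (x₀ * y₁ + x₁ * y₁) + (x₁ * y₂ + x₀ * y₂) ≤⟨ +-mono-≤
    (+-monoˡ-≤ (x₁ * y₁) (C-spread m r s (<⇒≤ r<s)))
    (+-mono-≤ (C-spread m (suc r) (suc s) (m≤n⇒m≤1+n r<s))
      -- The outermost product `x₀ * y₂` is moved inwards twice, through `x₁ * y₁` to `x₂ * y₀`. The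
      -- second move uses `r < s`, which is why the case of equality is split off first.
      (≤-trans (C-spread m r (suc s) (m≤n⇒m≤1+n (<⇒≤ r<s))) (C-spread m (suc r) s r<s))) ⟩
  (x₁ * y₀ + x₁ * y₁) + (x₂ * y₁ + x₂ * y₀) ≡⟨ collect x₁ x₂ y₀ y₁ ⟩
  (x₁ + x₂) * (y₀ + y₁)                     ∎
  where
  open ≤-Reasoning
  x₀ x₁ x₂ y₀ y₁ y₂ : ℕ
  x₀ = m C r
  x₁ = m C suc r
  x₂ = m C suc (suc r)
  y₀ = m C s
  y₁ = m C suc s
  y₂ = m C suc (suc s)
  expand : ∀ a b c d → (a + b) * (c + d) ≡ (a * c + b * c) + (b * d + a * d)
  expand = solve-∀
  collect : ∀ a b c d → (a * c + a * d) + (b * d + b * c) ≡ (a + b) * (c + d)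
  collect = solve-∀

C-logConcave : ∀ m r → (m C r) * (m C suc (suc r)) ≤ (m C suc r) * (m C suc r)
C-logConcave m r = C-spread m r (suc r) (n≤1+n r)

extend-inside : ∀ n l k → suc k ≤ n → extend n l (suc k) ≡ l (suc k)
extend-inside n l k k<n with suc k ≤ᵇ n | ≤⇒≤ᵇ k<n
... | true | _ = refl

extend-suc≤ : ∀ n l k → extend n l (suc k) ≤ l (suc k)
extend-suc≤ n l k with suc k ≤ᵇ n
... | true  = ≤-refl
... | false = z≤n

-- At the left end the product vanishes because the extension is 0 at index 0. At the right end the
-- extension by zero only lowers the product, so `extend-suc≤` covers it together with the interior.
logConcave-intro : ∀ n {l f : ℕ → ℕ} → (∀ r → l (suc r) ≡ f r) →
  (∀ r → f r * f (2 + r) ≤ f (suc r) * f (suc r)) → LogConcave n l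
logConcave-intro n         _   _  (suc zero)    _ _   = z≤n
logConcave-intro n {l} {f} l≡f lc (suc (suc r)) _ k≤n = begin
  extend n l (suc r) * extend n l (3 + r) ≤⟨ *-mono-≤ (extend-suc≤ n l r) (extend-suc≤ n l (2 + r)) ⟩
  l (suc r) * l (3 + r)                   ≡⟨ cong₂ _*_ (l≡f r) (l≡f (2 + r)) ⟩
  f r * f (2 + r)                         ≤⟨ lc r ⟩
  f (suc r) * f (suc r)                   ≡⟨ cong (f (suc r) *_) (*-identityʳ _) ⟨
  f (suc r) ^ 2                           ≡⟨ cong (_^ 2) (trans (extend-inside n l (suc r) k≤n) (l≡f (suc r))) ⟨
  extend n l (2 + r) ^ 2                  ∎
  where open ≤-Reasoning

-- The pigeonhole principle for a relation rather than a function: one coding relation, used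
-- directly and flipped, then gives both inequalities of a count.
length-≤ : ∀ {A B : Set} (R : A → B → Set) {xs ys} → Unique xs →
  (∀ {x} → x ∈ xs → ∃ λ y → y ∈ ys × R x y) →
  (∀ {x x′ y} → x ∈ xs → x′ ∈ xs → R x y → R x′ y → x ≡ x′) →
  length xs ≤ length ys
length-≤ R {[]} _ _ _ = z≤n
length-≤ R {x ∷ xs} (x∉ ∷ u) total inj with total (here refl)
... | y , y∈ , Rxy with ∈-∃++ y∈
...   | as , bs , refl = ≤-trans (s≤s (length-≤ R u total′ (λ p q → inj (there p) (there q))))
  (≤-reflexive (sym (trans (length-++ as)
    (trans (+-suc (length as) (length bs)) (cong suc (sym (length-++ as)))))))
  where
  total′ : ∀ {x′} → x′ ∈ xs → ∃ λ y′ → y′ ∈ as ++ bs × R x′ y′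
  total′ x′∈ with total (there x′∈)
  ... | y′ , y′∈ , Rx′y′ with ∈-++⁻ as y′∈
  ...   | inj₁ ∈as         = y′ , ∈-++⁺ˡ ∈as , Rx′y′
  ...   | inj₂ (there ∈bs) = y′ , ∈-++⁺ʳ as ∈bs , Rx′y′
  ...   | inj₂ (here refl) = contradiction (inj (here refl) (there x′∈) Rxy Rx′y′) (All.lookup x∉ x′∈)

-- Counting

backwards : ∀ {n m} → Vec (Fin n) m → List ℕ
backwards w = reverse (map (λ i → suc (toℕ i)) (toList w))

length-backwards : ∀ {n m} (w : Vec (Fin n) m) → length (backwards w) ≡ m
length-backwards w = trans (length-reverse (map _ (toList w)))
  (trans (length-map _ (toList w)) (length-toList w))

backwards-injective : ∀ {n m} {w v : Vec (Fin n) m} → backwards w ≡ backwards v → w ≡ v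
backwards-injective {w = w} {v} eq = trans (sym (cast-is-id refl w))
  (toList-injective refl w v
    (map-injective (λ p → Fin.toℕ-injective (suc-injective p)) (reverse-injective eq)))

backwards-surjective : ∀ {n} xs → (∀ {v} → v ∈ xs → 1 ≤ v × v ≤ n) →
  ∃ λ (w : Vec (Fin n) (length xs)) → backwards w ≡ xs
backwards-surjective {n} xs bounded =
  subst (λ k → ∃ λ (w : Vec (Fin n) k) → backwards w ≡ xs) (length-reverse xs)
  (proj₁ vec , trans (cong reverse (proj₂ vec)) (reverse-involutive xs))
  where
  forwards : ∀ us → All (λ v → 1 ≤ v × v ≤ n) us →
    ∃ λ (w : Vec (Fin n) (length us)) → map (λ i → suc (toℕ i)) (toList w) ≡ us
  forwards []       []                   = [] , refl
  forwards (suc u ∷ us) ((_ , u<n) ∷ ps) with forwards us ps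
  ... | w , eq = fromℕ< u<n ∷ w , cong₂ _∷_ (cong suc (Fin.toℕ-fromℕ< u<n)) eq
  vec : ∃ λ (w : Vec (Fin n) (length (reverse xs))) → map (λ i → suc (toℕ i)) (toList w) ≡ reverse xs
  vec = forwards (reverse xs) (All-resp-↭ (↭-sym (↭-reverse xs)) (All.tabulate bounded))

At-∷ʳ-last : ∀ zs {u} → At (zs ∷ʳ u) 1 u
At-∷ʳ-last []       = here
At-∷ʳ-last (z ∷ zs) = there (At-∷ʳ-last zs)

At-∷ʳ : ∀ {zs u i v} → At zs i v → At (zs ∷ʳ u) (suc i) v
At-∷ʳ {z ∷ zs} {u} here =
  subst (λ k → At (z ∷ zs ∷ʳ u) (suc k) z) (length-∷ʳ zs {u}) here
At-∷ʳ (there at) = there (At-∷ʳ at)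

At-backwards : ∀ {n m} (w : Vec (Fin n) m) i →
  At (backwards w) (suc (toℕ i)) (suc (toℕ (lookup w i)))
At-backwards (x ∷ w) i = subst (λ xs → At xs (suc (toℕ i)) (suc (toℕ (lookup (x ∷ w) i))))
  (sym (unfold-reverse (suc (toℕ x)) (map (λ i → suc (toℕ i)) (toList w)))) (at-snoc i)
  where
  at-snoc : ∀ i → At (backwards w ∷ʳ suc (toℕ x)) (suc (toℕ i)) (suc (toℕ (lookup (x ∷ w) i)))
  at-snoc zero    = At-∷ʳ-last (backwards w)
  at-snoc (suc i) = At-∷ʳ (At-backwards w i)

At-backwards⁻ : ∀ {n m} (w : Vec (Fin n) m) {j v} → At (backwards w) j v →
  ∃ λ i → j ≡ suc (toℕ i) × v ≡ suc (toℕ (lookup w i))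
At-backwards⁻ w {zero} at with () ← At-> at
At-backwards⁻ w {suc j} at = i , j≡ , At-functional at
  (subst (λ k → At (backwards w) k (suc (toℕ (lookup w i)))) (sym j≡) (At-backwards w i))
  where
  j<m = subst (suc j ≤_) (length-backwards w) (At-≤ at)
  i = fromℕ< j<m
  j≡ : suc j ≡ suc (toℕ i)
  j≡ = cong suc (sym (Fin.toℕ-fromℕ< j<m))

∈-At : ∀ {v xs} → v ∈ xs → ∃ λ i → At xs i v
∈-At (here refl) = _ , here
∈-At (there v∈)  with ∈-At v∈
... | i , at = i , there at

At-injective⇒unique : ∀ xs → (∀ {i j v} → At xs i v → At xs j v → i ≡ j) → Unique xs
At-injective⇒unique []       inj = []
At-injective⇒unique (x ∷ xs) inj =
  All.tabulate fresh ∷ At-injective⇒unique xs (λ p q → inj (there p) (there q))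
  where
  fresh : ∀ {v} → v ∈ xs → x ≢ v
  fresh v∈ refl with ∈-At v∈
  ... | i , at = 1+n≰n (subst (_≤ length xs) (sym (inj here (there at))) (At-≤ at))

unique⇒At-injective : ∀ {xs i j v} → Unique xs → At xs i v → At xs j v → i ≡ j
unique⇒At-injective _        here       here       = refl
unique⇒At-injective (x∉ ∷ _) here       (there at) = contradiction refl (All.lookup x∉ (At-∈ at))
unique⇒At-injective (x∉ ∷ _) (there at) here       = contradiction refl (All.lookup x∉ (At-∈ at))
unique⇒At-injective (_ ∷ u)  (there p)  (there q)  = unique⇒At-injective u p q

backwards-permutation⁺ : ∀ {n} (w : Vec (Fin n) n) → IsPermutation w →
  IsPermutationList n (backwards w)
backwards-permutation⁺ {n} w (inj , surj) = record
  { unique   = At-injective⇒unique (backwards w) At-inj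
  ; bounded  = bounded′
  ; complete = complete′
  }
  where
  At-inj : ∀ {i j v} → At (backwards w) i v → At (backwards w) j v → i ≡ j
  At-inj p q with At-backwards⁻ w p | At-backwards⁻ w q
  ... | i , refl , refl | j , refl , eq =
    cong (suc ∘ toℕ) (inj (Fin.toℕ-injective (suc-injective eq)))
  bounded′ : ∀ {v} → v ∈ backwards w → 1 ≤ v × v ≤ n
  bounded′ v∈ with At-backwards⁻ w (proj₂ (∈-At v∈))
  ... | i , _ , refl = s≤s z≤n , Fin.toℕ<n (lookup w i)
  complete′ : ∀ {v} → 1 ≤ v → v ≤ n → v ∈ backwards w
  complete′ {suc v} _ v<n with surj (fromℕ< v<n)
  ... | i , w[i]≡ = subst (_∈ backwards w)
    (cong suc (trans (cong toℕ (w[i]≡ refl)) (Fin.toℕ-fromℕ< v<n)))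
    (At-∈ (At-backwards w i))

backwards-permutation⁻ : ∀ {n} (w : Vec (Fin n) n) → IsPermutationList n (backwards w) →
  IsPermutation w
backwards-permutation⁻ {n} w perm = inj , surj
  where
  inj : ∀ {i j} → lookup w i ≡ lookup w j → i ≡ j
  inj {i} {j} eq = Fin.toℕ-injective (suc-injective (unique⇒At-injective (unique perm)
    (At-backwards w i)
    (subst (λ x → At (backwards w) (suc (toℕ j)) (suc (toℕ x))) (sym eq) (At-backwards w j))))
  surj : ∀ y → ∃ λ x → ∀ {z} → z ≡ x → lookup w z ≡ y
  surj y with At-backwards⁻ w (proj₂ (∈-At (complete perm (s≤s z≤n) (Fin.toℕ<n y))))
  ... | i , _ , eq = i , λ { refl → sym (Fin.toℕ-injective (suc-injective eq)) }

record Inverses {n} (w v : Vec (Fin n) n) : Set where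
  constructor inverses
  field
    cancelʳ : ∀ i → lookup w (lookup v i) ≡ i
    cancelˡ : ∀ i → lookup v (lookup w i) ≡ i
open Inverses

inverses-sym : ∀ {n} {w v : Vec (Fin n) n} → Inverses w v → Inverses v w
inverses-sym (inverses p q) = inverses q p

inverses-permutation : ∀ {n} {w v : Vec (Fin n) n} → Inverses w v → IsPermutation w
inverses-permutation {w = w} {v} (inverses wv vw) =
  (λ {i} {j} eq → trans (sym (vw i)) (trans (cong (lookup v) eq) (vw j))) ,
  λ y → lookup v y , λ { refl → wv y }

inverse-exists : ∀ {n} (w : Vec (Fin n) n) → IsPermutation w → ∃ λ v → Inverses w v
inverse-exists w (inj , surj) = v , inverses wv (λ i → inj (wv (lookup w i)))
  where
  v = tabulate (λ y → proj₁ (surj y))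
  wv : ∀ i → lookup w (lookup v i) ≡ i
  wv i = trans (cong (lookup w) (lookup∘tabulate _ i)) (proj₂ (surj i) refl)

inverse-unique : ∀ {n} {w v v′ : Vec (Fin n) n} → Inverses w v → Inverses w v′ → v ≡ v′
inverse-unique {w = w} {v} {v′} (inverses wv _) (inverses _ v′w) = trans (sym (tabulate∘lookup v))
  (trans (tabulate-cong (λ i → trans (sym (v′w (lookup v i))) (cong (lookup v′) (wv i))))
    (tabulate∘lookup v′))

inverses-transpose : ∀ {n} {w v : Vec (Fin n) n} → Inverses w v →
  Transposes (backwards w) (backwards v)
inverses-transpose {w = w} {v} (inverses _ vw) at with At-backwards⁻ w at
... | i , refl , refl =
  subst (λ x → At (backwards v) (suc (toℕ (lookup w i))) (suc (toℕ x))) (vw i)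
    (At-backwards v (lookup w i))

backwards-positive : ∀ {n} (w : Vec (Fin n) n) → IsPermutation w → All (0 <_) (backwards w)
backwards-positive w p = All.tabulate (λ v∈ → proj₁ (bounded (backwards-permutation⁺ w p) v∈))

HasHookRun : ∀ {n} → ℕ → Vec (Fin n) n → Set
HasHookRun k w = ∃₂ λ r c → ∃ λ d → Run (backwards w) r c d × length r ≡ k

hook⇒run : ∀ {m k} (w : Vec (Fin (suc m)) (suc m)) → IsPermutation w →
  ℓ w ≡ k → IsHook (suc m) (sh w) → HasHookRun k w
hook⇒run {m} w perm ℓ≡k hook =
  let r , c , d , run = nonempty (backwards w) (length-backwards w) (unique (backwards-permutation⁺ w perm))
        (subst HookLike (tab-reverse (oneLine w)) (hookLike hook))
  in r , c , d , run , trans (sym (run-lis {oneLine w}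
       (All-resp-↭ (↭-reverse (oneLine w)) (backwards-positive w perm)) run)) ℓ≡k
  where
  nonempty : ∀ xs → length xs ≡ suc m → Unique xs → HookLike (tab xs) →
    ∃₂ λ r c → ∃ λ d → Run xs r c d
  nonempty (x ∷ xs) _ u h = hookLike⇒run x xs u h
  replicate-≤1 : ∀ j → All (_≤ 1) (replicate j 1)
  replicate-≤1 zero    = []
  replicate-≤1 (suc j) = ≤-refl ∷ replicate-≤1 j
  hookLike : IsHook (suc m) (sh w) → HookLike (proj₁ (RS (oneLine w)))
  hookLike (j , _ , _ , eq) = subst (λ s → All (_≤ 1) (drop 1 s)) (sym eq) (replicate-≤1 (suc m ∸ j))

run⇒hook : ∀ {n k} (w : Vec (Fin n) n) → IsPermutation w → HasHookRun k w →
  ℓ w ≡ k × IsHook n (sh w)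
run⇒hook {n} w perm (r , c , d , run , refl) =
  run-lis {oneLine w} (All-resp-↭ (↭-reverse (oneLine w)) (backwards-positive w perm)) run ,
  (length r , m+n≤o⇒m≤o (length r) (≤-reflexive size) ,
    subst (1 ≤_) (sym (proj₁ (run-length run))) (s≤s z≤n) ,
    trans (cong shape (trans (tab-reverse (oneLine w)) (run-tab run)))
      (cong (length r ∷_) (trans (singletons c)
        (cong (λ j → replicate j 1)
          (trans (sym (m+n∸m≡n (length r) (length c))) (cong (_∸ length r) size))))))
  where
  size : length r + length c ≡ n
  size = trans (sym (length-++ r)) (trans (sym (↭-length (run-↭ run))) (length-backwards w))
  singletons : ∀ c → shape (map [_] c) ≡ replicate (length c) 1
  singletons []      = refl
  singletons (_ ∷ c) = cong (1 ∷_) (singletons c)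

inverse-hookRun : ∀ {n k} {w v : Vec (Fin n) n} → Inverses w v → HasHookRun k w → HasHookRun k v
inverse-hookRun {w = w} {v} inv (r , c , d , run , refl)
  with run-transpose (backwards-positive w (inverses-permutation inv))
         (unique (backwards-permutation⁺ v (inverses-permutation (inverses-sym inv))))
         (trans (length-backwards v) (sym (length-backwards w)))
         (inverses-transpose inv) run
... | r′ , c′ , (d′ , run′) , len = r′ , c′ , d′ , run′ , len

code : ∀ {n} → Vec (Fin n) n → List Bool
code w = ascs (backwards w)

length-code : ∀ {m} (w : Vec (Fin (suc m)) (suc m)) → length (code w) ≡ m
length-code w with backwards w | length-backwards w
... | x ∷ xs | eq = trans (length-ascs x xs) (suc-injective eq)

trues-code : ∀ {n k} (w : Vec (Fin n) n) → HasHookRun (suc k) w → trues (code w) ≡ k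
trues-code w (r , c , d , run , len) =
  trans (cong trues (sym (run-ascs run))) (suc-injective (trans (sym (proj₁ (run-length run))) len))

code∈ : ∀ {m k} (w : Vec (Fin (suc m)) (suc m)) → HasHookRun (suc k) w → code w ∈ binaryWords m k
code∈ w h = subst₂ (λ i j → code w ∈ binaryWords i j) (length-code w) (trues-code w h)
  (∈-binaryWords⁺ (code w))

inverse-places : ∀ {m r c d} {w v : Vec (Fin (suc m)) (suc m)} → Inverses w v →
  Run (backwards w) r c d → Places r c (code v)
inverse-places {w = w} {v} inv run
  with backwards v | length-backwards v | inverses-transpose (inverses-sym inv)
... | y ∷ ys | _ | t = run-places (unique (backwards-permutation⁺ w (inverses-permutation inv))) run y ys t

hook-determined : ∀ {m k k′} {w w′ v v′ : Vec (Fin (suc m)) (suc m)} →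
  Inverses w v → Inverses w′ v′ → HasHookRun k w → HasHookRun k′ w′ →
  code w ≡ code w′ → code v ≡ code v′ → w ≡ w′
hook-determined {w = w} {w′} {v} inv inv′ (r , c , d , run , _) (r′ , c′ , d′ , run′ , _) w≡w′ v≡v′ =
  backwards-injective (run-determined (length-code v)
    (backwards-permutation⁺ w (inverses-permutation inv))
    (backwards-permutation⁺ w′ (inverses-permutation inv′))
    run (subst (Run _ r′ c′) (trans (run-ascs run′) (trans (sym w≡w′) (sym (run-ascs run)))) run′)
    (inverse-places inv run)
    (subst (Places r′ c′) (sym v≡v′) (inverse-places inv′ run′)))

-- The tableau is built from `e` and the insertion run back along `d`. The code of the inverse
-- describes the places in that same tableau, so `places-functional` identifies it with `e`.
hook-exists : ∀ {m k d e} → d ∈ binaryWords m k → e ∈ binaryWords m k →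
  ∃₂ λ (w v : Vec (Fin (suc m)) (suc m)) →
    Inverses w v × HasHookRun (suc k) w × code w ≡ d × code v ≡ e
hook-exists {m} {k} {d} {e} d∈ e∈ with ∈-binaryWords⁻ m k d∈ | ∈-binaryWords⁻ m k e∈
... | ld , td | refl , te with permutationList-exists d e ld (trans td (sym te))
... | xs , perm , run with subst (λ j → ∃ λ (w : Vec (Fin (suc m)) j) → backwards w ≡ xs) length-xs
                            (backwards-surjective xs (bounded perm))
  where
  length-xs : length xs ≡ suc m
  length-xs = trans (↭-length (run-↭ run)) (trans (↭-length (rowOf-colOf-↭ e))
    (trans (length-map suc (downFrom (suc m))) (length-downFrom (suc m))))
... | w , refl with inverse-exists w (backwards-permutation⁻ w perm)
... | v , inv = w , v , inv , (_ , _ , d , run , trans (length-rowOf e) (cong suc te)) , sym (run-ascs run) ,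
  places-functional (run-disjoint (unique perm) run) (length-code v) (inverse-places inv run) (places-of e)

words-complete : ∀ {n m} (w : Vec (Fin n) m) → w ∈ words n m
words-complete []      = here refl
words-complete (x ∷ w) = ∈-cartesianProductWith⁺ _∷_ (∈-allFin x) (words-complete w)

words-unique : ∀ n m → Unique (words n m)
words-unique n zero    = [] ∷ []
words-unique n (suc m) =
  Unique.cartesianProductWith⁺ _∷_ Vec.∷-injective (Unique.allFin⁺ n) (words-unique n m)

𝔖-complete : ∀ {n} {w : Vec (Fin n) n} → IsPermutation w → w ∈ 𝔖 n
𝔖-complete p = ∈-filter⁺ isPermutation? (words-complete _) p

𝔖-permutation : ∀ {n} {w : Vec (Fin n) n} → w ∈ 𝔖 n → IsPermutation w
𝔖-permutation {n} w∈ = proj₂ (∈-filter⁻ isPermutation? {xs = words n n} w∈)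

𝔖-unique : ∀ n → Unique (𝔖 n)
𝔖-unique n = Unique.filter⁺ isPermutation? (words-unique n n)

length-cartesianProduct : ∀ {A B : Set} (xs : List A) (ys : List B) →
  length (cartesianProduct xs ys) ≡ length xs * length ys
length-cartesianProduct []       ys = refl
length-cartesianProduct (x ∷ xs) ys = trans (length-++ (map (x ,_) ys))
  (cong₂ _+_ (length-map (x ,_) ys) (length-cartesianProduct xs ys))

-- The inverse enters existentially, as it is available only for permutations; `inverse-unique`
-- keeps the relation single-valued.
DoubleCode : ∀ {n} → Vec (Fin n) n → List Bool × List Bool → Set
DoubleCode w (d , e) = code w ≡ d × ∃ λ v → Inverses w v × code v ≡ e

ℓ-hook-count : ∀ m k → ℓ-hook (suc m) (suc k) ≡ (m C k) * (m C k)
ℓ-hook-count m k = trans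
  (≤-antisym
    (length-≤ DoubleCode (Unique.filter⁺ hook? (𝔖-unique (suc m))) encode
      (λ { w∈ w′∈ (cw , v , inv , cv) (cw′ , v′ , inv′ , cv′) →
        hook-determined inv inv′ (hookRun w∈) (hookRun w′∈) (trans cw (sym cw′)) (trans cv (sym cv′)) }))
    (length-≤ (flip DoubleCode)
      (Unique.cartesianProduct⁺ (binaryWords-unique m k) (binaryWords-unique m k)) decode
      (λ { {d , e} {d′ , e′} _ _ (refl , v , inv , refl) (refl , v′ , inv′ , refl) →
        cong (λ u → (_ , code u)) (inverse-unique inv inv′) })))
  (trans (length-cartesianProduct (binaryWords m k) (binaryWords m k))
    (cong₂ _*_ (length-binaryWords m k) (length-binaryWords m k)))
  where
  hook? = λ (w : Vec (Fin (suc m)) (suc m)) → (ℓ w ≟ suc k) ×-dec isHook? (suc m) (sh w)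
  hooks = filter hook? (𝔖 (suc m))
  hookRun : ∀ {w} → w ∈ hooks → HasHookRun (suc k) w
  hookRun {w} w∈ with ∈-filter⁻ hook? {xs = 𝔖 (suc m)} w∈
  ... | w∈𝔖 , ℓ≡ , hook = hook⇒run w (𝔖-permutation w∈𝔖) ℓ≡ hook
  encode : ∀ {w} → w ∈ hooks →
    ∃ λ de → de ∈ cartesianProduct (binaryWords m k) (binaryWords m k) × DoubleCode w de
  encode {w} w∈ with inverse-exists w (𝔖-permutation (proj₁ (∈-filter⁻ hook? {xs = 𝔖 (suc m)} w∈)))
  ... | v , inv = (code w , code v) ,
    ∈-cartesianProduct⁺ (code∈ w (hookRun w∈)) (code∈ v (inverse-hookRun inv (hookRun w∈))) ,
    refl , v , inv , refl
  decode : ∀ {de} → de ∈ cartesianProduct (binaryWords m k) (binaryWords m k) →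
    ∃ λ w → w ∈ hooks × DoubleCode w de
  decode {d , e} de∈ with ∈-cartesianProduct⁻ (binaryWords m k) (binaryWords m k) de∈
  ... | d∈ , e∈ with hook-exists d∈ e∈
  ...   | w , v , inv , h , cw , cv =
    w , ∈-filter⁺ hook? (𝔖-complete (inverses-permutation inv)) (run⇒hook w (inverses-permutation inv) h) ,
    cw , v , inv , cv

i-hook-count : ∀ m k → i-hook (suc m) (suc k) ≡ m C k
i-hook-count m k = trans
  (≤-antisym
    (length-≤ HasCode (Unique.filter⁺ hook? (𝔖-unique (suc m)))
      (λ {w} w∈ → code w , code∈ w (hookRun w∈) , refl)
      (λ { w∈ w′∈ refl eq → hook-determined (self-inverse w∈) (self-inverse w′∈)
             (hookRun w∈) (hookRun w′∈) (sym eq) (sym eq) }))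
    (length-≤ (flip HasCode) (binaryWords-unique m k) decode (λ { _ _ refl refl → refl })))
  (length-binaryWords m k)
  where
  hook? = λ (w : Vec (Fin (suc m)) (suc m)) →
    isInvolution? w ×-dec ((ℓ w ≟ suc k) ×-dec isHook? (suc m) (sh w))
  hooks = filter hook? (𝔖 (suc m))
  HasCode : Vec (Fin (suc m)) (suc m) → List Bool → Set
  HasCode w d = code w ≡ d
  hookRun : ∀ {w} → w ∈ hooks → HasHookRun (suc k) w
  hookRun {w} w∈ with ∈-filter⁻ hook? {xs = 𝔖 (suc m)} w∈
  ... | w∈𝔖 , _ , ℓ≡ , hook = hook⇒run w (𝔖-permutation w∈𝔖) ℓ≡ hook
  self-inverse : ∀ {w} → w ∈ hooks → Inverses w w
  self-inverse w∈ with ∈-filter⁻ hook? {xs = 𝔖 (suc m)} w∈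
  ... | _ , ww , _ = inverses ww ww
  -- The permutation with code d whose inverse also has code d is its own inverse.
  decode : ∀ {d} → d ∈ binaryWords m k → ∃ λ w → w ∈ hooks × HasCode w d
  decode d∈ with hook-exists d∈ d∈
  ... | w , v , inv , h , cw , cv
    with hook-determined inv (inverses-sym inv) h (inverse-hookRun inv h)
           (trans cw (sym cv)) (trans cv (sym cw))
  ...   | refl = w , ∈-filter⁺ hook? (𝔖-complete perm) (cancelʳ inv , run⇒hook w perm h) , cw
    where perm = inverses-permutation inv

theorem3p1 : ∀ (n : ℕ) → 1 ≤ n → LogConcave n (ℓ-hook n) × LogConcave n (i-hook n)
theorem3p1 (suc m) _ =
  logConcave-intro (suc m) {ℓ-hook (suc m)} (ℓ-hook-count m) C²-logConcave ,
  logConcave-intro (suc m) {i-hook (suc m)} (i-hook-count m) (C-logConcave m)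
  where
  C²-logConcave : ∀ r → ((m C r) * (m C r)) * ((m C (2 + r)) * (m C (2 + r))) ≤
    ((m C suc r) * (m C suc r)) * ((m C suc r) * (m C suc r))
  -- After regrouping the factors, this is the inequality for binomial coefficients multiplied by
  -- itself.
  C²-logConcave r = ≤-trans
    (≤-reflexive ([m*n]*[o*p]≡[m*o]*[n*p] (m C r) (m C r) (m C (2 + r)) (m C (2 + r))))
    (*-mono-≤ (C-logConcave m r) (C-logConcave m r))
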